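{- Let $\mu$ be Lebesgue measure on $[0,1]$, for $t\in[0,1]$ let $t^0=[0,t]$ and $t^1=[1-t,1]$, and let $\mathcal{I}_0=\{a^0 : 0\le a\le 1\}$. Define on $\mathcal{I}_0$ the operations $a^0\odot b^0=[\mu(a^0\cap b^1)]^0$ and $\neg a^0=[\mu([0,1]\setminus a^0)]^0$, and let $0=0^0=[0,0]$ and $1=1^0=[0,1]$. Then $(\mathcal{I}_0,\odot,\neg,1,0)$ is an MV-algebra (with $\odot$ as the monoid operation, $1=[0,1]$ as its identity element, and $0=[0,0]$ in the role of the last constant of the MV-algebra signature).
   Context: In $[\mu(X)]^0$ the real number $\mu(X)\in[0,1]$ plays the role of $t$, i.e. $[\mu(X)]^0=[0,\mu(X)]$. An MV-algebra is a structure $(A,+,\neg,e,u)$ such that $(A,+,e)$ is a commutative monoid with identity $e$, and for all $x,y\in A$: (i) $\neg(\neg x)=x$; (ii) $u+x=u$; (iii) $x+\neg e=\neg e$; (iv) $\neg(\neg x+y)+y=\neg(\neg y+x)+x$. -}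

module Defs where

open import Algebra.Core using (Op₁; Op₂)
open import Algebra.Definitions using (Congruent₁)
open import Algebra.Structures using (IsCommutativeMonoid)
open import Data.Nat.Base as ℕ using (ℕ; zero; suc)
open import Data.Product.Base using (Σ-syntax; ∃-syntax; _×_; _,_)
open import Data.Rational.Base as ℚ using (ℚ; 0ℚ; 1ℚ; ½)
import Data.Rational.Properties as ℚₚ
open import Data.Rational.Solver using (module +-*-Solver)
open import Function.Base using (id)
open import Level using (0ℓ; _⊔_)
open import Relation.Binary.Core using (Rel)
open import Relation.Binary.PropositionalEquality using (_≡_; refl; sym)
open import Relation.Nullary.Negation.Core using (¬_)
open import Relation.Unary using (Pred; _∈_; _⊆_; _≐_; _∩_; _∖_)

-- Real numbers are rational Cauchy sequences with error at most δ n = 2⁻ⁿ.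
-- No excluded middle is assumed; sets of reals are compared by _≐_.

δ : ℕ → ℚ
δ zero    = 1ℚ
δ (suc n) = ½ ℚ.* δ n

-- The bound holds for (m , n) and for (n , m), so it is
-- ∣ seq m - seq n ∣ ≤ δ m + δ n.
record ℝ : Set where
  constructor mkℝ
  field
    seq     : ℕ → ℚ
    regular : ∀ m n → seq m ℚ.- seq n ℚ.≤ δ m ℚ.+ δ n

open ℝ public

infix  4 _<_ _≤_
infixl 6 _+_ _-_
infix  8 -_

_<_ : Rel ℝ 0ℓ
x < y = ∃[ n ] seq x n ℚ.+ δ n ℚ.< seq y n ℚ.- δ n

_≤_ : Rel ℝ 0ℓ
x ≤ y = ¬ (y < x)

0≤δ : ∀ n → 0ℚ ℚ.≤ δ n
0≤δ zero    = ℚₚ.nonNegative⁻¹ 1ℚ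
0≤δ (suc n) = ℚₚ.≤-trans (ℚₚ.≤-reflexive (sym (ℚₚ.*-zeroʳ ½)))
                         (ℚₚ.*-monoˡ-≤-nonNeg ½ (0≤δ n))

fromℚ : ℚ → ℝ
fromℚ q .seq _       = q
fromℚ q .regular m n = ℚₚ.≤-trans (ℚₚ.≤-reflexive (ℚₚ.+-inverseʳ q))
                                  (ℚₚ.+-mono-≤ (0≤δ m) (0≤δ n))

0ℝ 1ℝ : ℝ
0ℝ = fromℚ 0ℚ
1ℝ = fromℚ 1ℚ

-- The index shift absorbs the doubling of the error.
_+_ : ℝ → ℝ → ℝ
(x + y) .seq n       = seq x (suc n) ℚ.+ seq y (suc n)
(x + y) .regular m n = begin
  (x₁ ℚ.+ y₁) ℚ.- (x₂ ℚ.+ y₂)      ≡⟨ rearrange x₁ y₁ x₂ y₂ ⟩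
  (x₁ ℚ.- x₂) ℚ.+ (y₁ ℚ.- y₂)      ≤⟨ ℚₚ.+-mono-≤ (regular x (suc m) (suc n))
                                                   (regular y (suc m) (suc n)) ⟩
  (½ ℚ.* δ m ℚ.+ ½ ℚ.* δ n) ℚ.+
  (½ ℚ.* δ m ℚ.+ ½ ℚ.* δ n)        ≡⟨ double (δ m) (δ n) ⟩
  δ m ℚ.+ δ n                      ∎
  where
  open ℚₚ.≤-Reasoning
  open +-*-Solver
  x₁ = seq x (suc m)
  x₂ = seq x (suc n)
  y₁ = seq y (suc m)
  y₂ = seq y (suc n)
  rearrange : ∀ a b c d → (a ℚ.+ b) ℚ.- (c ℚ.+ d) ≡ (a ℚ.- c) ℚ.+ (b ℚ.- d)
  rearrange = solve 4 (λ a b c d → (a :+ b) :- (c :+ d) := (a :- c) :+ (b :- d)) refl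
  double : ∀ a b → (½ ℚ.* a ℚ.+ ½ ℚ.* b) ℚ.+ (½ ℚ.* a ℚ.+ ½ ℚ.* b) ≡ a ℚ.+ b
  double = solve 2 (λ a b → (con ½ :* a :+ con ½ :* b) :+ (con ½ :* a :+ con ½ :* b)
                            := a :+ b) refl

-_ : ℝ → ℝ
(- x) .seq n       = ℚ.- seq x n
(- x) .regular m n = begin
  (ℚ.- seq x m) ℚ.- (ℚ.- seq x n)  ≡⟨ swap (seq x m) (seq x n) ⟩
  seq x n ℚ.- seq x m              ≤⟨ regular x n m ⟩
  δ n ℚ.+ δ m                      ≡⟨ ℚₚ.+-comm (δ n) (δ m) ⟩
  δ m ℚ.+ δ n                      ∎
  where
  open ℚₚ.≤-Reasoning
  open +-*-Solver
  swap : ∀ a b → (ℚ.- a) ℚ.- (ℚ.- b) ≡ b ℚ.- a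
  swap = solve 2 (λ a b → (:- a) :- (:- b) := b :- a) refl

_-_ : ℝ → ℝ → ℝ
x - y = x + (- y)

fromℚ-mono-≤ : ∀ p q → p ℚ.≤ q → fromℚ p ≤ fromℚ q
fromℚ-mono-≤ p q p≤q (n , q+δ<p-δ) = ℚₚ.<-irrefl refl (begin-strict
  q           ≡⟨ ℚₚ.+-identityʳ q ⟨
  q ℚ.+ 0ℚ    ≤⟨ ℚₚ.+-monoʳ-≤ q (0≤δ n) ⟩
  q ℚ.+ δ n   <⟨ q+δ<p-δ ⟩
  p ℚ.- δ n   ≤⟨ ℚₚ.+-monoʳ-≤ p (ℚₚ.neg-antimono-≤ (0≤δ n)) ⟩
  p ℚ.+ 0ℚ    ≡⟨ ℚₚ.+-identityʳ p ⟩
  p           ≤⟨ p≤q ⟩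
  q           ∎)
  where open ℚₚ.≤-Reasoning

Subset : Set₁
Subset = Pred ℝ 0ℓ

[_⋯_] : ℝ → ℝ → Subset
[ a ⋯ b ] x = a ≤ x × x ≤ b

𝕀 : Subset
𝕀 = [ 0ℝ ⋯ 1ℝ ]

-- Possibly empty (lo = hi), so that countable covers include finite ones.
record OpenInterval : Set where
  field
    lo hi : ℝ
    lo≤hi : lo ≤ hi

  contains : Subset
  contains x = lo < x × x < hi

  len : ℝ
  len = hi - lo

open OpenInterval public

Covers : (ℕ → OpenInterval) → Subset → Set
Covers I E = ∀ {x} → x ∈ E → ∃[ n ] x ∈ contains (I n)

partialSum : (ℕ → ℝ) → ℕ → ℝ
partialSum f zero    = 0ℝ
partialSum f (suc n) = partialSum f n + f n

HasSum : (ℕ → ℝ) → ℝ → Set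
HasSum f s = ∀ ε → 0ℝ < ε → ∃[ N ] ∀ n → N ℕ.≤ n →
  s - ε < partialSum f n × partialSum f n < s + ε

CoverTotal : Subset → Pred ℝ 0ℓ
CoverTotal E t = ∃[ I ] Covers I E × HasSum (λ n → len (I n)) t

IsInfimum : Pred ℝ 0ℓ → ℝ → Set
IsInfimum P m = (∀ t → t ∈ P → m ≤ t) ×
                (∀ ε → 0ℝ < ε → ∃[ t ] t ∈ P × t < m + ε)

-- Covers of infinite total length do not affect the infimum, as bounded
-- sets also have covers of finite total length.
HasOuterMeasure : Subset → ℝ → Set
HasOuterMeasure E m = IsInfimum (CoverTotal E) m

HasInnerMeasure : Subset → ℝ → Set
HasInnerMeasure E m = HasOuterMeasure (𝕀 ∖ E) (1ℝ - m)

-- Lebesgue's definition, for subsets of the unit interval: E is measurable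
-- when its outer and inner measures agree, and μ E is the common value.
record Measurable (E : Subset) : Set where
  field
    μ     : ℝ
    E⊆𝕀   : E ⊆ 𝕀
    outer : HasOuterMeasure E μ
    inner : HasInnerMeasure E μ

open Measurable public using (μ)

record IsMVAlgebra {a ℓ} {A : Set a} (_≈_ : Rel A ℓ)
                   (_⊕_ : Op₂ A) (∼_ : Op₁ A) (e u : A) : Set (a ⊔ ℓ) where
  field
    isCommutativeMonoid : IsCommutativeMonoid _≈_ _⊕_ e
    ∼-cong              : Congruent₁ _≈_ ∼_
    ∼-involutive        : ∀ x → (∼ (∼ x)) ≈ x
    u-absorbs           : ∀ x → (u ⊕ x) ≈ u
    ∼e-absorbs          : ∀ x → (x ⊕ (∼ e)) ≈ (∼ e)
    exchange            : ∀ x y → ((∼ ((∼ x) ⊕ y)) ⊕ y) ≈ ((∼ ((∼ y) ⊕ x)) ⊕ x)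

infix 9 _⁰ _¹

_⁰ : ℝ → Subset
t ⁰ = [ 0ℝ ⋯ t ]

_¹ : ℝ → Subset
t ¹ = [ 1ℝ - t ⋯ 1ℝ ]

record 𝓘₀ : Set₁ where
  field
    set     : Subset
    initial : ∃[ a ] a ∈ 𝕀 × set ≐ a ⁰

open 𝓘₀ public using (set)

_≋_ : Rel 𝓘₀ 0ℓ
X ≋ Y = set X ≐ set Y

𝟎 𝟏 : 𝓘₀
𝟎 = record
  { set     = 0ℝ ⁰
  ; initial = 0ℝ , (fromℚ-mono-≤ 0ℚ 0ℚ ℚₚ.≤-refl , fromℚ-mono-≤ 0ℚ 1ℚ (ℚₚ.nonNegative⁻¹ 1ℚ)) , id , id
  }
𝟏 = record
  { set     = 1ℝ ⁰
  ; initial = 1ℝ , (fromℚ-mono-≤ 0ℚ 1ℚ (ℚₚ.nonNegative⁻¹ 1ℚ) , fromℚ-mono-≤ 1ℚ 1ℚ ℚₚ.≤-refl) , id , id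
  }

-- The equations determine both operations up to _≋_; an inhabitant also
-- witnesses that the sets being measured are measurable and that the
-- results do not depend on the representing a and b.
record Operations : Set₁ where
  infixl 7 _⊙_
  infix  8 ∼_
  field
    _⊙_   : Op₂ 𝓘₀
    ∼_    : Op₁ 𝓘₀
    ⊙-def : ∀ X Y {a b} → a ∈ 𝕀 → b ∈ 𝕀 → set X ≐ a ⁰ → set Y ≐ b ⁰ →
            Σ[ M ∈ Measurable (a ⁰ ∩ b ¹) ] set (X ⊙ Y) ≐ (μ M) ⁰
    ∼-def : ∀ X {a} → a ∈ 𝕀 → set X ≐ a ⁰ →
            Σ[ M ∈ Measurable (𝕀 ∖ a ⁰) ] set (∼ X) ≐ (μ M) ⁰

{-# OPTIONS --safe #-}
module Submission where

-- A cover of E and a cover of 𝕀 ∖ E have lengths summing to at least 1.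
-- Otherwise enlarge all intervals to rational endpoints and bisect [0, 1],
-- always keeping a half in which the intervals have total length less than that
-- of the half. As the series of lengths converge, a finite part decides which
-- half to keep. The limit point lies in none of the intervals, but neither can
-- it lie outside E, nor in E. So if E and 𝕀 ∖ E have covers of lengths
-- arbitrarily close to m and 1 - m, then μ E = m.
--
-- For E = a⁰ ∩ b¹ = [1 - b, a] and m = max (0, a - (1 - b)), the complement is
-- covered up to ε by intervals around [0, 1 - b] and [max (1 - b, a), 1], with
-- no need to decide whether a < 1 - b. Since μ is unique, any Operations are
-- a⁰ ⊙ b⁰ = max (0, a + b - 1)⁰ and ¬ a⁰ = (1 - a)⁰.

-- Compactness cannot replace the bisection: the Heine-Borel theorem is not constructive, and
-- recursive mathematics even has countable covers of [0, 1] whose partial sums of lengths all stay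
-- below 1/2. What excludes these is that `HasSum` asks for convergence, with an explicit index for
-- every error. Rational endpoints are needed because only rational comparisons can be decided. Two
-- covers are treated at once, as it is not decidable whether a point lies in E. Their lengths also
-- bound each other from below: covers of the complement with length near 1 - m show that no cover
-- of E is shorter than m, and conversely. Thus only upper estimates, by explicit covers, are ever
-- computed.

open import Defs
open import Data.Empty using (⊥-elim)
open import Data.Fin.Base using (Fin; zero; suc)
open import Data.Integer.Base as ℤ using (+_)
import Data.Integer.Properties as ℤₚ
open import Data.Nat.Base as ℕ using (ℕ; zero; suc)
import Data.Nat.Properties as ℕₚ
open import Data.Product.Base using (Σ-syntax; ∃-syntax; _×_; _,_; proj₁; proj₂; swap)
open import Data.Rational.Base as ℚ using (ℚ; 0ℚ; 1ℚ; ½; mkℚ)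
import Data.Rational.Properties as ℚₚ
open import Data.Rational.Solver using (module +-*-Solver)
import Data.Rational.Unnormalised.Base as ℚᵘ
import Data.Rational.Unnormalised.Properties as ℚᵘₚ
open import Data.Sum.Base using (_⊎_; inj₁; inj₂; [_,_]′)
open import Data.Vec.Base using (Vec; []; _∷_; lookup; map; zipWith; replicate; allFin)
open import Data.Vec.N-ary using (N-ary; Eq; curryⁿ; curryⁿ-cong; _$ⁿ_)
open import Data.Vec.Properties using (lookup-map)
open import Function.Base using (_∘_; id)
open import Relation.Binary.Core using (Rel)
open import Relation.Binary.PropositionalEquality
open import Relation.Binary.Structures using (IsEquivalence; IsPreorder)
import Relation.Binary.Reasoning.Base.Triple as Triple
open import Relation.Nullary.Decidable.Core using (yes; no)
open import Relation.Nullary.Negation.Core using (¬_; contradiction)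
open import Relation.Unary using (Pred; _∈_; _∖_; _⊆_; _∩_; _≐_)
open import Relation.Unary.Properties using (≐-refl; ≐-sym; ≐-trans)

open +-*-Solver using (con; _:+_; _:*_; :-_; _:=_) renaming (solve to ring)

-- A linear inequality follows from the sum a ≤ b of its premises once the
-- solver has checked that y - x = b - a.
≤-from : ∀ {a b x y} → a ℚ.≤ b → y ℚ.+ a ≡ x ℚ.+ b → x ℚ.≤ y
≤-from {a} {b} {x} {y} a≤b eq with x ℚₚ.≤? y
... | yes x≤y = x≤y
... | no x≰y = contradiction (ℚₚ.+-mono-<-≤ (ℚₚ.≰⇒> x≰y) a≤b) (ℚₚ.<-irrefl eq)

<-from : ∀ {a b x y} → a ℚ.< b → y ℚ.+ a ≡ x ℚ.+ b → x ℚ.< y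
<-from {a} {b} {x} {y} a<b eq with x ℚₚ.<? y
... | yes x<y = x<y
... | no x≮y = contradiction (ℚₚ.+-mono-≤-< (ℚₚ.≮⇒≥ x≮y) a<b) (ℚₚ.<-irrefl eq)

infixl 6 _⊞_

_⊞_ : ∀ {a b c d} → a ℚ.≤ b → c ℚ.≤ d → a ℚ.+ c ℚ.≤ b ℚ.+ d
_⊞_ = ℚₚ.+-mono-≤

-- Powers of one half and the Archimedean property

0<δ : ∀ n → 0ℚ ℚ.< δ n
0<δ zero    = ℚₚ.positive⁻¹ 1ℚ
0<δ (suc n) = subst (ℚ._< δ (suc n)) (ℚₚ.*-zeroʳ ½) (ℚₚ.*-monoʳ-<-pos ½ (0<δ n))

δ-antitone : ∀ {m n} → m ℕ.≤ n → δ n ℚ.≤ δ m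
δ-antitone {n = zero}  ℕ.z≤n     = ℚₚ.≤-refl
δ-antitone {n = suc n} ℕ.z≤n     = ≤-from (δ-antitone {n = n} ℕ.z≤n ⊞ 0≤δ (suc n))
  (ring 1 (λ d → con 1ℚ :+ (d :+ con 0ℚ) := con ½ :* d :+ (con 1ℚ :+ con ½ :* d)) refl (δ n))
δ-antitone (ℕ.s≤s m≤n) = ℚₚ.*-monoˡ-≤-nonNeg ½ (δ-antitone m≤n)

-- Recursive, so that `ι (suc n)` unfolds to a sum that the ring solver can treat.
ι : ℕ → ℚ
ι zero    = 0ℚ
ι (suc n) = 1ℚ ℚ.+ ι n

toℚᵘ-ι : ∀ n → ℚ.toℚᵘ (ι n) ℚᵘ.≃ ℚᵘ.mkℚᵘ (+ n) 0
toℚᵘ-ι zero    = ℚᵘₚ.≃-refl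
toℚᵘ-ι (suc n) = ℚᵘₚ.≃-trans (ℚₚ.toℚᵘ-homo-+ 1ℚ (ι n))
  (ℚᵘₚ.≃-trans (ℚᵘₚ.+-congʳ (ℚ.toℚᵘ 1ℚ) (toℚᵘ-ι n))
    (ℚᵘ.*≡* (cong (λ z → (+ 1 ℤ.+ z) ℤ.* + 1) (ℤₚ.*-identityʳ (+ n)))))

≤-ι : ∀ q → ∃[ n ] q ℚ.≤ ι n
≤-ι q@(mkℚ p d _) = ℤ.∣ p ∣ , ℚₚ.toℚᵘ-cancel-≤ (ℚᵘₚ.≤-respʳ-≃ (ℚᵘₚ.≃-sym (toℚᵘ-ι ℤ.∣ p ∣))
  (ℚᵘ.*≤* (bound p)))
  where
  bound : ∀ i → i ℤ.* + 1 ℤ.≤ + ℤ.∣ i ∣ ℤ.* + suc d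
  bound (+ n)      = ℤₚ.*-monoˡ-≤-nonNeg (+ n) (ℤ.+≤+ (ℕ.s≤s ℕ.z≤n))
  bound ℤ.-[1+ n ] = ℤ.-≤+

-- This is n + 1 ≤ 2ⁿ. The induction step halves the sum of `ι (suc n) * δ n ≤ 1` and `δ n ≤ 1`.
ι*δ≤1 : ∀ n → ι (suc n) ℚ.* δ n ℚ.≤ 1ℚ
ι*δ≤1 zero    = ℚₚ.≤-refl
ι*δ≤1 (suc n) = ≤-from (ℚₚ.*-monoˡ-≤-nonNeg ½ (ι*δ≤1 n ⊞ δ-antitone {n = n} ℕ.z≤n))
  (ring 2 (λ i d → con 1ℚ :+ con ½ :* ((con 1ℚ :+ i) :* d :+ d) :=
                    (con 1ℚ :+ (con 1ℚ :+ i)) :* (con ½ :* d) :+ con ½ :* (con 1ℚ :+ con 1ℚ))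
    refl (ι n) (δ n))

-- With n ≥ C / g, the product C δ n is at most g n δ n. Strictness comes from passing to g (n + 1)
-- δ n, which is still at most g.
archimedean′ : ∀ C {g} → 0ℚ ℚ.< g → ∃[ n ] C ℚ.* δ n ℚ.< g
archimedean′ C {g} 0<g = n , (begin-strict
    C ℚ.* δ n                        ≡⟨ cong (ℚ._* δ n) C≡ ⟩
    (g ℚ.* (C ℚ.÷ g)) ℚ.* δ n        ≡⟨ ℚₚ.*-assoc g _ _ ⟩
    g ℚ.* ((C ℚ.÷ g) ℚ.* δ n)        ≤⟨ ℚₚ.*-monoˡ-≤-nonNeg g (ℚₚ.*-monoʳ-≤-nonNeg (δ n) C/g≤ι) ⟩
    g ℚ.* (ι n ℚ.* δ n)              <⟨ ℚₚ.*-monoʳ-<-pos g ι<ι ⟩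
    g ℚ.* (ι (suc n) ℚ.* δ n)        ≤⟨ ℚₚ.*-monoˡ-≤-nonNeg g (ι*δ≤1 n) ⟩
    g ℚ.* 1ℚ                         ≡⟨ ℚₚ.*-identityʳ g ⟩
    g                                ∎)
  where
  open ℚₚ.≤-Reasoning
  instance
    g-positive = ℚ.positive 0<g
    g-nonZero = ℚₚ.pos⇒nonZero g
    g-nonNegative = ℚₚ.pos⇒nonNeg g
  n = proj₁ (≤-ι (C ℚ.÷ g))
  instance
    δn-nonNegative = ℚ.nonNegative (0≤δ n)
  C/g≤ι = proj₂ (≤-ι (C ℚ.÷ g))
  ι<ι : ι n ℚ.* δ n ℚ.< ι (suc n) ℚ.* δ n
  ι<ι = <-from {a = 0ℚ} (0<δ n)
    (ring 2 (λ i d → (con 1ℚ :+ i) :* d :+ con 0ℚ := i :* d :+ d) refl (ι n) (δ n))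
  C≡ : C ≡ g ℚ.* (C ℚ.÷ g)
  C≡ = begin-equality
    C                          ≡⟨ ℚₚ.*-identityʳ C ⟨
    C ℚ.* 1ℚ                   ≡⟨ cong (C ℚ.*_) (ℚₚ.*-inverseʳ g) ⟨
    C ℚ.* (g ℚ.* ℚ.1/ g)       ≡⟨ ring 3 (λ C g h → C :* (g :* h) := g :* (C :* h)) refl C g (ℚ.1/ g) ⟩
    g ℚ.* (C ℚ.÷ g)            ∎

-- Abstract, so that the type checker never unfolds the index it returns.
abstract
  archimedean : ∀ C {g} → 0ℚ ℚ.< g → ∃[ n ] C ℚ.* δ n ℚ.< g
  archimedean = archimedean′

δ-double : ∀ n → δ (suc n) ℚ.+ δ (suc n) ≡ δ n
δ-double n = ring 1 (λ d → con ½ :* d :+ con ½ :* d := d) refl (δ n)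

δ-quadruple : ∀ n → δ (2 ℕ.+ n) ℚ.+ δ (2 ℕ.+ n) ℚ.+ (δ (2 ℕ.+ n) ℚ.+ δ (2 ℕ.+ n)) ≡ δ n
δ-quadruple n = trans (cong₂ ℚ._+_ (δ-double (suc n)) (δ-double (suc n))) (δ-double n)

-- Linear expressions

infix  8 ⊝_
infixl 6 _⊕_ _⊖_
infix  4 _⊜_

-- One syntax with readings in both ℚ and ℝ, so that what is checked for rationals can be carried
-- over to reals.
data Expr (n : ℕ) : Set where
  var  : Fin n → Expr n
  rat  : ℚ → Expr n
  _⊕_  : Expr n → Expr n → Expr n
  ⊝_   : Expr n → Expr n

_⊖_ : ∀ {n} → Expr n → Expr n → Expr n
e ⊖ f = e ⊕ ⊝ f

Equation : ℕ → Set
Equation n = Expr n × Expr n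

_⊜_ : ∀ {n} → Expr n → Expr n → Equation n
_⊜_ = _,_

close : ∀ n → N-ary n (Expr n) (Equation n) → Equation n
close n f = f $ⁿ map var (allFin n)

⟦_⟧ℚ : ∀ {n} → Expr n → Vec ℚ n → ℚ
⟦ var i ⟧ℚ ρ = lookup ρ i
⟦ rat q ⟧ℚ ρ = q
⟦ e ⊕ f ⟧ℚ ρ = ⟦ e ⟧ℚ ρ ℚ.+ ⟦ f ⟧ℚ ρ
⟦ ⊝ e ⟧ℚ   ρ = ℚ.- ⟦ e ⟧ℚ ρ

_·_ : ∀ {n} → Vec ℚ n → Vec ℚ n → ℚ
[]       · []       = 0ℚ
(c ∷ cs) · (x ∷ xs) = c ℚ.* x ℚ.+ cs · xs

unit : ∀ {n} → Fin n → Vec ℚ n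
unit zero    = 1ℚ ∷ replicate _ 0ℚ
unit (suc i) = 0ℚ ∷ unit i

-- The coefficients, that of the constant 1 first.
normalise : ∀ {n} → Expr n → Vec ℚ (suc n)
normalise (var i) = unit (suc i)
normalise (rat q) = q ∷ replicate _ 0ℚ
normalise (e ⊕ f) = zipWith ℚ._+_ (normalise e) (normalise f)
normalise (⊝ e)   = map ℚ.-_ (normalise e)

0-· : ∀ {n} (ρ : Vec ℚ n) → replicate n 0ℚ · ρ ≡ 0ℚ
0-· []      = refl
0-· (x ∷ ρ) = trans (cong (0ℚ ℚ.* x ℚ.+_) (0-· ρ))
  (ring 1 (λ x → con 0ℚ :* x :+ con 0ℚ := con 0ℚ) refl x)

unit-· : ∀ {n} i (ρ : Vec ℚ n) → unit i · ρ ≡ lookup ρ i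
unit-· zero    (x ∷ ρ) = trans (cong (1ℚ ℚ.* x ℚ.+_) (0-· ρ))
  (ring 1 (λ x → con 1ℚ :* x :+ con 0ℚ := x) refl x)
unit-· (suc i) (x ∷ ρ) = trans (cong (0ℚ ℚ.* x ℚ.+_) (unit-· i ρ))
  (ring 2 (λ x y → con 0ℚ :* x :+ y := y) refl x (lookup ρ i))

+-· : ∀ {n} (c d ρ : Vec ℚ n) → zipWith ℚ._+_ c d · ρ ≡ c · ρ ℚ.+ d · ρ
+-· []      []      []      = refl
+-· (p ∷ c) (q ∷ d) (x ∷ ρ) = trans (cong ((p ℚ.+ q) ℚ.* x ℚ.+_) (+-· c d ρ))
  (ring 5 (λ p q x s t → (p :+ q) :* x :+ (s :+ t) := p :* x :+ s :+ (q :* x :+ t)) refl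
    p q x (c · ρ) (d · ρ))

neg-· : ∀ {n} (c ρ : Vec ℚ n) → map ℚ.-_ c · ρ ≡ ℚ.- (c · ρ)
neg-· []      []      = refl
neg-· (p ∷ c) (x ∷ ρ) = trans (cong ((ℚ.- p) ℚ.* x ℚ.+_) (neg-· c ρ))
  (ring 3 (λ p x s → (:- p) :* x :+ :- s := :- (p :* x :+ s)) refl p x (c · ρ))

normalise-correct : ∀ {n} (e : Expr n) ρ → normalise e · (1ℚ ∷ ρ) ≡ ⟦ e ⟧ℚ ρ
normalise-correct (var i) ρ = unit-· (suc i) (1ℚ ∷ ρ)
normalise-correct (rat q) ρ = trans (cong (q ℚ.* 1ℚ ℚ.+_) (0-· ρ))
  (ring 1 (λ q → q :* con 1ℚ :+ con 0ℚ := q) refl q)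
normalise-correct (e ⊕ f) ρ = trans (+-· (normalise e) (normalise f) (1ℚ ∷ ρ))
  (cong₂ ℚ._+_ (normalise-correct e ρ) (normalise-correct f ρ))
normalise-correct (⊝ e)   ρ = trans (neg-· (normalise e) (1ℚ ∷ ρ))
  (cong ℚ.-_ (normalise-correct e ρ))

normalise-sound : ∀ {n} (e f : Expr n) → normalise e ≡ normalise f →
                  ∀ ρ → ⟦ e ⟧ℚ ρ ≡ ⟦ f ⟧ℚ ρ
normalise-sound e f eq ρ = trans (sym (normalise-correct e ρ))
  (trans (cong (_· (1ℚ ∷ ρ)) eq) (normalise-correct f ρ))

-- The premise compares coefficient vectors, in which the variables do not occur. For numeral
-- constants it is closed by `refl`.
solve : ∀ n (f : N-ary n (Expr n) (Equation n)) →
        let e , e′ = close n f in normalise e ≡ normalise e′ →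
        Eq n _≡_ (curryⁿ ⟦ e ⟧ℚ) (curryⁿ ⟦ e′ ⟧ℚ)
solve n f eq = let e , e′ = close n f in
  curryⁿ-cong _≡_ ⟦ e ⟧ℚ ⟦ e′ ⟧ℚ (normalise-sound e e′ eq)

-- Order on the real numbers

infix 4 _⊑_ _⊒_

-- Rational bounds that a single term of the sequence supplies (`⊑-seq`, `⊒-seq`) and from which a
-- strict inequality can be rebuilt (`≺-intro`).
_⊑_ _⊒_ : ℝ → ℚ → Set
x ⊑ q = ∀ m → seq x m ℚ.≤ q ℚ.+ δ m
x ⊒ q = ∀ m → q ℚ.≤ seq x m ℚ.+ δ m

⊑-seq : ∀ x n → x ⊑ seq x n ℚ.+ δ n
⊑-seq x n m = ≤-from (regular x m n)
  (solve 4 (λ a b d e → b ⊕ d ⊕ e ⊕ (a ⊖ b) ⊜ a ⊕ (e ⊕ d)) refl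
    (seq x m) (seq x n) (δ n) (δ m))

⊒-seq : ∀ x n → x ⊒ seq x n ℚ.- δ n
⊒-seq x n m = ≤-from (regular x n m)
  (solve 4 (λ a b d e → a ⊕ e ⊕ (b ⊖ a) ⊜ b ⊖ d ⊕ (d ⊕ e)) refl
    (seq x m) (seq x n) (δ n) (δ m))

2ℚ : ℚ
2ℚ = 1ℚ ℚ.+ 1ℚ

abstract
  archimedean-2δ : ∀ C {g} → 0ℚ ℚ.< g → ∃[ m ] C ℚ.* δ m ℚ.+ (δ m ℚ.+ δ m) ℚ.< g
  archimedean-2δ C {g} 0<g =
    let m , small = archimedean (C ℚ.+ 2ℚ) 0<g in
    m , subst (ℚ._< g)
      (ring 2 (λ C e → (C :+ con 2ℚ) :* e := C :* e :+ (e :+ e)) refl C (δ m)) small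

  δ-small : ∀ {g} → 0ℚ ℚ.< g → ∃[ m ] (δ m ℚ.+ δ m) ℚ.+ (δ m ℚ.+ δ m) ℚ.< g
  δ-small {g} 0<g =
    let m , small = archimedean (2ℚ ℚ.+ 2ℚ) 0<g in
    m , subst (ℚ._< g)
      (ring 1 (λ d → con (2ℚ ℚ.+ 2ℚ) :* d := (d :+ d) :+ (d :+ d)) refl (δ m)) small

gap : ∀ {p q} → p ℚ.< q → 0ℚ ℚ.< q ℚ.- p
gap {p} {q} p<q = <-from p<q (solve 2 (λ p q → q ⊖ p ⊕ p ⊜ rat 0ℚ ⊕ q) refl p q)

<⊎≥ : ∀ p q → p ℚ.< q ⊎ q ℚ.≤ p
<⊎≥ p q with p ℚₚ.<? q
... | yes p<q = inj₁ p<q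
... | no  p≮q = inj₂ (ℚₚ.≮⇒≥ p≮q)

infix 4 _≺_ _≼_ _≃_

-- As records the relations determine their endpoints, which Agda cannot
-- infer from the unfolded _<_ and _≤_.
record _≺_ (x y : ℝ) : Set where
  constructor <⇒≺
  field ≺⇒< : x < y

record _≼_ (x y : ℝ) : Set where
  constructor ≤⇒≼
  field ≼⇒≤ : x ≤ y

open _≺_ public
open _≼_ public

_≃_ : Rel ℝ _
x ≃ y = x ≼ y × y ≼ x

-- At an index m with 4 δ m < q - p, the terms satisfy xₘ + δ m ≤ p + 2 δ m < q - 2 δ m ≤ yₘ - δ m.
≺-intro : ∀ x y {p q} → p ℚ.< q → x ⊑ p → y ⊒ q → x ≺ y
≺-intro x y {p} {q} p<q x⊑p y⊒q =
  let m , small = δ-small (gap p<q) in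
  <⇒≺ (m , <-from (ℚₚ.+-mono-<-≤ small (x⊑p m ⊞ y⊒q m))
    (solve 5 (λ x y p q d → y ⊖ d ⊕ ((d ⊕ d ⊕ (d ⊕ d)) ⊕ (x ⊕ q))
                         ⊜ x ⊕ d ⊕ ((q ⊖ p) ⊕ ((p ⊕ d) ⊕ (y ⊕ d)))) refl
      (seq x m) (seq y m) p q (δ m)))

≺-asym : ∀ {x y} → x ≺ y → ¬ (y ≺ x)
≺-asym {x} {y} (<⇒≺ (n , x<y)) (<⇒≺ (m , y<x)) = ℚₚ.<-irrefl
  (solve 6 (λ a b c d s t →
     (b ⊕ t) ⊕ (c ⊕ s) ⊕ ((a ⊖ b) ⊕ (d ⊖ c)) ⊜ (d ⊖ t) ⊕ (a ⊖ s) ⊕ ((s ⊕ t) ⊕ (t ⊕ s)))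
    refl (seq x m) (seq x n) (seq y m) (seq y n) (δ m) (δ n))
  (ℚₚ.+-mono-<-≤ (ℚₚ.+-mono-< x<y y<x) (regular x m n ⊞ regular y n m))

-- The constructive substitute for deciding the order: a rational approximation of z, fine in
-- comparison with the gap between x and y, is compared with the upper end of that gap.
≺-cotrans : ∀ {x y} → x ≺ y → ∀ z → x ≺ z ⊎ z ≺ y
≺-cotrans {x} {y} (<⇒≺ (n , x<y)) z =
  let m , small = δ-small (gap x<y) in
  [ (λ z<y → inj₂ (≺-intro z y z<y (⊑-seq z m) (⊒-seq y n)))
  , (λ z≥y → inj₁ (≺-intro x z {seq x n ℚ.+ δ n} {seq z m ℚ.- δ m}
        (<-from (ℚₚ.+-mono-<-≤ small (z≥y ⊞ (0≤δ m ⊞ 0≤δ m)))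
          (solve 4 (λ z d p q → z ⊖ d ⊕ (d ⊕ d ⊕ (d ⊕ d) ⊕ (q ⊕ (rat 0ℚ ⊕ rat 0ℚ))) ⊜
                                p ⊕ (q ⊖ p ⊕ (z ⊕ d ⊕ (d ⊕ d)))) refl
            (seq z m) (δ m) (seq x n ℚ.+ δ n) (seq y n ℚ.- δ n)))
        (⊑-seq x n) (⊒-seq z m)))
  ]′ (<⊎≥ (seq z m ℚ.+ δ m) (seq y n ℚ.- δ n))

⊀⇒≽ : ∀ {x y} → ¬ (y ≺ x) → x ≼ y
⊀⇒≽ y⊀x = ≤⇒≼ (y⊀x ∘ <⇒≺)

≼⇒⊁ : ∀ {x y} → x ≼ y → ¬ (y ≺ x)
≼⇒⊁ x≼y y≺x = ≼⇒≤ x≼y (≺⇒< y≺x)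

≺⇒≼ : ∀ {x y} → x ≺ y → x ≼ y
≺⇒≼ x≺y = ⊀⇒≽ (≺-asym x≺y)

-- Since `≼` is a negation, it gives no witness. The witness comes from cotransitivity, one of whose
-- alternatives `≼` refutes.
≼-≺-trans : ∀ {x y z} → x ≼ y → y ≺ z → x ≺ z
≼-≺-trans {x} x≼y y≺z =
  [ (λ y≺x → contradiction y≺x (≼⇒⊁ x≼y)) , id ]′ (≺-cotrans y≺z x)

≺-≼-trans : ∀ {x y z} → x ≺ y → y ≼ z → x ≺ z
≺-≼-trans {z = z} x≺y y≼z =
  [ id , (λ z≺y → contradiction z≺y (≼⇒⊁ y≼z)) ]′ (≺-cotrans x≺y z)

≺-trans : ∀ {x y z} → x ≺ y → y ≺ z → x ≺ z
≺-trans x≺y = ≼-≺-trans (≺⇒≼ x≺y)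

≼-refl : ∀ {x} → x ≼ x
≼-refl = ⊀⇒≽ λ x≺x → ≺-asym x≺x x≺x

≼-trans : ∀ {x y z} → x ≼ y → y ≼ z → x ≼ z
≼-trans x≼y y≼z = ⊀⇒≽ λ z≺x → ≼⇒⊁ x≼y (≼-≺-trans y≼z z≺x)

≃-isEquivalence : IsEquivalence _≃_
≃-isEquivalence = record
  { refl  = ≼-refl , ≼-refl
  ; sym   = swap
  ; trans = λ (x≼y , y≼x) (y≼z , z≼y) → ≼-trans x≼y y≼z , ≼-trans z≼y y≼x
  }

open IsEquivalence ≃-isEquivalence public
  using () renaming (refl to ≃-refl; sym to ≃-sym; trans to ≃-trans)

≼-isPreorder : IsPreorder _≃_ _≼_
≼-isPreorder = record
  { isEquivalence = ≃-isEquivalence ; reflexive = proj₁ ; trans = ≼-trans }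

module ≼-Reasoning = Triple ≼-isPreorder ≺-asym ≺-trans
  ((λ (y≼z , _) x≺y → ≺-≼-trans x≺y y≼z) , (λ (_ , z≼y) y≺x → ≼-≺-trans z≼y y≺x))
  ≺⇒≼ ≺-≼-trans ≼-≺-trans

-- A fixed multiple of `δ n` is a harmless error: a strict `y < x` would leave a rational gap that
-- exceeds `C * δ m + 2 δ m` for large m.
≼-intro : ∀ {x y} C → (∀ n → seq x n ℚ.≤ seq y n ℚ.+ C ℚ.* δ n) → x ≼ y
≼-intro {x} {y} C x≤y+Cδ = ⊀⇒≽ λ (<⇒≺ (n , y<x)) →
  let m , small = archimedean-2δ C (gap y<x) in
  ℚₚ.<-irrefl
    (solve 7 (λ x₁ x₂ y₁ y₂ d e Ce →
        Ce ⊕ (e ⊕ e) ⊕ (x₂ ⊕ ((x₁ ⊖ x₂) ⊕ (y₂ ⊖ y₁))) ⊜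
        ((x₁ ⊖ d) ⊖ (y₁ ⊕ d)) ⊕ ((y₂ ⊕ Ce) ⊕ ((d ⊕ e) ⊕ (e ⊕ d))))
      refl (seq x n) (seq x m) (seq y n) (seq y m) (δ n) (δ m) (C ℚ.* δ m))
    (ℚₚ.+-mono-<-≤ small (x≤y+Cδ m ⊞ (regular x n m ⊞ regular y m n)))

-- Transfer of linear arithmetic from rational to real numbers

infix  8 ∹_
infixl 6 _∔_ _∸_

-- Opaque copies of the operations, because Agda compares sums of real numbers
-- by η-expansion and would then compare the regularity proofs.
opaque
  sum : Σ[ _⊞_ ∈ (ℝ → ℝ → ℝ) ] (∀ x y → x + y ≡ x ⊞ y)
  sum = _+_ , λ _ _ → refl

  opposite : Σ[ ⊟_ ∈ (ℝ → ℝ) ] (∀ x → - x ≡ ⊟ x)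
  opposite = -_ , λ _ → refl

_∔_ _∸_ : ℝ → ℝ → ℝ
_∔_ = proj₁ sum
x ∸ y = x ∔ proj₁ opposite y

∹_ : ℝ → ℝ
∹_ = proj₁ opposite

+≡∔ : ∀ x y → x + y ≡ x ∔ y
+≡∔ = proj₂ sum

-≡∸ : ∀ x y → x - y ≡ x ∸ y
-≡∸ x y = trans (+≡∔ x (- y)) (cong (x ∔_) (proj₂ opposite y))

⟦_⟧ℝ : ∀ {n} → Expr n → Vec ℝ n → ℝ
⟦ var i ⟧ℝ ρ = lookup ρ i
⟦ rat q ⟧ℝ ρ = fromℚ q
⟦ e ⊕ f ⟧ℝ ρ = ⟦ e ⟧ℝ ρ ∔ ⟦ f ⟧ℝ ρ
⟦ ⊝ e ⟧ℝ   ρ = ∹ ⟦ e ⟧ℝ ρ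

4ℚ : ℚ
4ℚ = 2ℚ ℚ.+ 2ℚ

-- A sum shifts the index of the sequences, which costs 2 δ k per summand.
error : ∀ {n} → Expr n → ℚ
error (var i) = 0ℚ
error (rat q) = 0ℚ
error (e ⊕ f) = error e ℚ.+ error f ℚ.+ 4ℚ
error (⊝ e)   = error e

sample : ∀ {n} → Vec ℝ n → ℕ → Vec ℚ n
sample ρ n = map (λ x → seq x n) ρ

step-≤ : ∀ x n → seq x (suc n) ℚ.≤ seq x n ℚ.+ (δ n ℚ.+ δ n)
step-≤ x n = ≤-from (regular x (suc n) n ⊞ δ-antitone (ℕₚ.n≤1+n n))
  (solve 4 (λ x y d e → y ⊕ (d ⊕ d) ⊕ (x ⊖ y ⊕ e) ⊜ x ⊕ (e ⊕ d ⊕ d)) refl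
    (seq x (suc n)) (seq x n) (δ n) (δ (suc n)))

step-≥ : ∀ x n → seq x n ℚ.≤ seq x (suc n) ℚ.+ (δ n ℚ.+ δ n)
step-≥ x n = ≤-from (regular x n (suc n) ⊞ δ-antitone (ℕₚ.n≤1+n n))
  (solve 4 (λ x y d e → x ⊕ (d ⊕ d) ⊕ (y ⊖ x ⊕ e) ⊜ y ⊕ (d ⊕ e ⊕ d)) refl
    (seq x (suc n)) (seq x n) (δ n) (δ (suc n)))

0*-≤ : ∀ {p q} d → p ≡ q → p ℚ.≤ q ℚ.+ 0ℚ ℚ.* d
0*-≤ {p} d refl = ℚₚ.≤-reflexive (ring 2 (λ p d → p := p :+ con 0ℚ :* d) refl p d)

≤-cast : ∀ q {p r s} → r ≡ s → p ℚ.≤ q ℚ.+ r → p ℚ.≤ q ℚ.+ s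
≤-cast _ refl p≤q+r = p≤q+r

error-⊕ : ∀ e f d → (e ℚ.+ f ℚ.+ 4ℚ) ℚ.* d ≡ e ℚ.* d ℚ.+ f ℚ.* d ℚ.+ (d ℚ.+ d ℚ.+ (d ℚ.+ d))
error-⊕ = ring 3 (λ e f d → (e :+ f :+ con 4ℚ) :* d := e :* d :+ f :* d :+ (d :+ d :+ (d :+ d))) refl

opaque
  unfolding sum

  -- The two bounds are proved together because negation exchanges them.
  ⟦⟧ℝ≤⟦⟧ℚ : ∀ {n} (e : Expr n) ρ k → seq (⟦ e ⟧ℝ ρ) k ℚ.≤ ⟦ e ⟧ℚ (sample ρ k) ℚ.+ error e ℚ.* δ k
  ⟦⟧ℚ≤⟦⟧ℝ : ∀ {n} (e : Expr n) ρ k → ⟦ e ⟧ℚ (sample ρ k) ℚ.≤ seq (⟦ e ⟧ℝ ρ) k ℚ.+ error e ℚ.* δ k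

  ⟦⟧ℝ≤⟦⟧ℚ (var i) ρ k = 0*-≤ (δ k) (sym (lookup-map i (λ x → seq x k) ρ))
  ⟦⟧ℝ≤⟦⟧ℚ (rat q) ρ k = 0*-≤ (δ k) refl
  ⟦⟧ℝ≤⟦⟧ℚ (e ⊕ f) ρ k = ≤-cast (⟦ e ⊕ f ⟧ℚ (sample ρ k)) (sym (error-⊕ (error e) (error f) (δ k))) (≤-from
    ((step-≤ (⟦ e ⟧ℝ ρ) k ⊞ ⟦⟧ℝ≤⟦⟧ℚ e ρ k) ⊞ (step-≤ (⟦ f ⟧ℝ ρ) k ⊞ ⟦⟧ℝ≤⟦⟧ℚ f ρ k))
    (solve 9 (λ x x′ y y′ p q ed fd d →
          p ⊕ q ⊕ (ed ⊕ fd ⊕ (d ⊕ d ⊕ (d ⊕ d))) ⊕ (x′ ⊕ x ⊕ (y′ ⊕ y)) ⊜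
          x′ ⊕ y′ ⊕ (x ⊕ (d ⊕ d) ⊕ (p ⊕ ed) ⊕ (y ⊕ (d ⊕ d) ⊕ (q ⊕ fd))))
        refl (seq (⟦ e ⟧ℝ ρ) k) (seq (⟦ e ⟧ℝ ρ) (suc k)) (seq (⟦ f ⟧ℝ ρ) k) (seq (⟦ f ⟧ℝ ρ) (suc k))
        (⟦ e ⟧ℚ (sample ρ k)) (⟦ f ⟧ℚ (sample ρ k)) (error e ℚ.* δ k) (error f ℚ.* δ k) (δ k)))
  ⟦⟧ℝ≤⟦⟧ℚ (⊝ e)   ρ k = ≤-from (⟦⟧ℚ≤⟦⟧ℝ e ρ k)
    (solve 3 (λ p x d → ⊝ p ⊕ d ⊕ p ⊜ ⊝ x ⊕ (x ⊕ d)) refl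
      (⟦ e ⟧ℚ (sample ρ k)) (seq (⟦ e ⟧ℝ ρ) k) (error e ℚ.* δ k))

  ⟦⟧ℚ≤⟦⟧ℝ (var i) ρ k = 0*-≤ (δ k) (lookup-map i (λ x → seq x k) ρ)
  ⟦⟧ℚ≤⟦⟧ℝ (rat q) ρ k = 0*-≤ (δ k) refl
  ⟦⟧ℚ≤⟦⟧ℝ (e ⊕ f) ρ k = ≤-cast (seq (⟦ e ⊕ f ⟧ℝ ρ) k) (sym (error-⊕ (error e) (error f) (δ k))) (≤-from
    ((step-≥ (⟦ e ⟧ℝ ρ) k ⊞ ⟦⟧ℚ≤⟦⟧ℝ e ρ k) ⊞ (step-≥ (⟦ f ⟧ℝ ρ) k ⊞ ⟦⟧ℚ≤⟦⟧ℝ f ρ k))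
    (solve 9 (λ x x′ y y′ p q ed fd d →
          x′ ⊕ y′ ⊕ (ed ⊕ fd ⊕ (d ⊕ d ⊕ (d ⊕ d))) ⊕ (x ⊕ p ⊕ (y ⊕ q)) ⊜
          p ⊕ q ⊕ (x′ ⊕ (d ⊕ d) ⊕ (x ⊕ ed) ⊕ (y′ ⊕ (d ⊕ d) ⊕ (y ⊕ fd))))
        refl (seq (⟦ e ⟧ℝ ρ) k) (seq (⟦ e ⟧ℝ ρ) (suc k)) (seq (⟦ f ⟧ℝ ρ) k) (seq (⟦ f ⟧ℝ ρ) (suc k))
        (⟦ e ⟧ℚ (sample ρ k)) (⟦ f ⟧ℚ (sample ρ k)) (error e ℚ.* δ k) (error f ℚ.* δ k) (δ k)))
  ⟦⟧ℚ≤⟦⟧ℝ (⊝ e)   ρ k = ≤-from (⟦⟧ℝ≤⟦⟧ℚ e ρ k)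
    (solve 3 (λ p x d → ⊝ x ⊕ d ⊕ x ⊜ ⊝ p ⊕ (p ⊕ d)) refl
      (⟦ e ⟧ℚ (sample ρ k)) (seq (⟦ e ⟧ℝ ρ) k) (error e ℚ.* δ k))

-- At every index the rational inequality holds for the sampled variables, and the real expressions
-- differ from the rational ones by multiples of `δ k` that do not depend on k.
transfer-≼ : ∀ {n} (e f : Expr n) → (∀ ρ → ⟦ e ⟧ℚ ρ ℚ.≤ ⟦ f ⟧ℚ ρ) → ∀ ρ → ⟦ e ⟧ℝ ρ ≼ ⟦ f ⟧ℝ ρ
transfer-≼ e f e≤f ρ = ≼-intro (error e ℚ.+ error f) λ k →
  ≤-cast (seq (⟦ f ⟧ℝ ρ) k) (sym (ℚₚ.*-distribʳ-+ (δ k) (error e) (error f))) (≤-from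
  (⟦⟧ℝ≤⟦⟧ℚ e ρ k ⊞ (e≤f (sample ρ k) ⊞ ⟦⟧ℚ≤⟦⟧ℝ f ρ k))
  (solve 6 (λ x y p q ed fd → y ⊕ (ed ⊕ fd) ⊕ (x ⊕ (p ⊕ q)) ⊜ x ⊕ (p ⊕ ed ⊕ (q ⊕ (y ⊕ fd))))
      refl (seq (⟦ e ⟧ℝ ρ) k) (seq (⟦ f ⟧ℝ ρ) k) (⟦ e ⟧ℚ (sample ρ k)) (⟦ f ⟧ℚ (sample ρ k))
      (error e ℚ.* δ k) (error f ℚ.* δ k)))

pointwise-≼ : ∀ {x y} → (∀ n → seq x n ℚ.≤ seq y n) → x ≼ y
pointwise-≼ x≤y = ≼-intro 0ℚ λ n → ℚₚ.≤-trans (x≤y n) (0*-≤ (δ n) refl)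

solveℝ : ∀ n (f : N-ary n (Expr n) (Equation n)) →
         let e , e′ = close n f in normalise e ≡ normalise e′ →
         Eq n _≃_ (curryⁿ ⟦ e ⟧ℝ) (curryⁿ ⟦ e′ ⟧ℝ)
solveℝ n f eq = let e , e′ = close n f in
  curryⁿ-cong _≃_ ⟦ e ⟧ℝ ⟦ e′ ⟧ℝ λ ρ →
    transfer-≼ e e′ (λ σ → ℚₚ.≤-reflexive (normalise-sound e e′ eq σ)) ρ ,
    transfer-≼ e′ e (λ σ → ℚₚ.≤-reflexive (sym (normalise-sound e e′ eq σ))) ρ

opaque
  unfolding sum

  -- Cancellation is the direct law: the sum at index n already consists of terms at `suc n`, which
  -- serves as witness. Monotonicity follows by cancelling `∹ z`.
  +-cancelʳ-≺ : ∀ x y z → x ∔ z ≺ y ∔ z → x ≺ y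
  +-cancelʳ-≺ x y z (<⇒≺ (n , x+z<y+z)) = <⇒≺ (suc n , <-from
    (ℚₚ.+-mono-<-≤ x+z<y+z (δ-antitone (ℕₚ.n≤1+n n) ⊞ δ-antitone (ℕₚ.n≤1+n n)))
    (solve 5 (λ x y z d e → y ⊖ e ⊕ (x ⊕ z ⊕ d ⊕ (e ⊕ e)) ⊜ x ⊕ e ⊕ (y ⊕ z ⊖ d ⊕ (d ⊕ d))) refl
      (seq x (suc n)) (seq y (suc n)) (seq z (suc n)) (δ n) (δ (suc n))))

x+z-z≃x : ∀ x z → x ∔ z ∔ ∹ z ≃ x
x+z-z≃x = solveℝ 2 (λ x z → x ⊕ z ⊕ ⊝ z ⊜ x) refl

+-monoˡ-≺ : ∀ z {x y} → x ≺ y → x ∔ z ≺ y ∔ z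
+-monoˡ-≺ z {x} {y} x≺y = +-cancelʳ-≺ (x ∔ z) (y ∔ z) (∹ z)
  (≼-≺-trans (proj₁ (x+z-z≃x x z)) (≺-≼-trans x≺y (proj₂ (x+z-z≃x y z))))

+-monoˡ-≼ : ∀ z {x y} → x ≼ y → x ∔ z ≼ y ∔ z
+-monoˡ-≼ z {x} {y} x≼y = ⊀⇒≽ (≼⇒⊁ x≼y ∘ +-cancelʳ-≺ y x z)

+-comm : ∀ x y → x ∔ y ≃ y ∔ x
+-comm = solveℝ 2 (λ x y → x ⊕ y ⊜ y ⊕ x) refl

+-mono-≼ : ∀ {x y u v} → x ≼ y → u ≼ v → x ∔ u ≼ y ∔ v
+-mono-≼ {x} {y} {u} {v} x≼y u≼v = begin
  x ∔ u  ≤⟨ +-monoˡ-≼ u x≼y ⟩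
  y ∔ u  ≈⟨ +-comm y u ⟩
  u ∔ y  ≤⟨ +-monoˡ-≼ y u≼v ⟩
  v ∔ y  ≈⟨ +-comm v y ⟩
  y ∔ v  ∎
  where open ≼-Reasoning

+-mono-≺-≼ : ∀ {x y u v} → x ≺ y → u ≼ v → x ∔ u ≺ y ∔ v
+-mono-≺-≼ {x} {y} {u} {v} x≺y u≼v = ≺-≼-trans (+-monoˡ-≺ u x≺y) (+-mono-≼ ≼-refl u≼v)

+-cong : ∀ {x y u v} → x ≃ y → u ≃ v → x ∔ u ≃ y ∔ v
+-cong (x≼y , y≼x) (u≼v , v≼u) = +-mono-≼ x≼y u≼v , +-mono-≼ y≼x v≼u

≺-from : ∀ {a b x y} → a ≺ b → y ∔ a ≃ x ∔ b → x ≺ y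
≺-from {a} {b} {x} {y} a≺b eq = +-cancelʳ-≺ x y b (begin-strict
  x ∔ b  ≈⟨ eq ⟨
  y ∔ a  ≈⟨ +-comm y a ⟩
  a ∔ y  <⟨ +-monoˡ-≺ y a≺b ⟩
  b ∔ y  ≈⟨ +-comm b y ⟩
  y ∔ b  ∎)
  where open ≼-Reasoning

≼-from : ∀ {a b x y} → a ≼ b → y ∔ a ≃ x ∔ b → x ≼ y
≼-from {a} {b} {x} {y} a≼b eq = ⊀⇒≽ λ y≺x →
  ≺-asym (≺-≼-trans (+-mono-≺-≼ y≺x a≼b) (proj₂ eq)) (≺-≼-trans (+-mono-≺-≼ y≺x a≼b) (proj₂ eq))

neg-mono-≼ : ∀ {x y} → x ≼ y → ∹ y ≼ ∹ x
neg-mono-≼ {x} {y} x≼y = ≼-from x≼y (solveℝ 2 (λ x y → ⊝ x ⊕ x ⊜ ⊝ y ⊕ y) refl x y)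

neg-cong : ∀ {x y} → x ≃ y → ∹ x ≃ ∹ y
neg-cong (x≼y , y≼x) = neg-mono-≼ y≼x , neg-mono-≼ x≼y

-- Rational numbers as real numbers

fromℚ-mono-≼ : ∀ {p q} → p ℚ.≤ q → fromℚ p ≼ fromℚ q
fromℚ-mono-≼ p≤q = pointwise-≼ λ _ → p≤q

opaque
  unfolding sum

  fromℚ-+ : ∀ p q → fromℚ (p ℚ.+ q) ≃ fromℚ p ∔ fromℚ q
  fromℚ-+ p q = pointwise-≼ (λ _ → ℚₚ.≤-refl) , pointwise-≼ (λ _ → ℚₚ.≤-refl)

fromℚ-⊑ : ∀ q → fromℚ q ⊑ q
fromℚ-⊑ q m = ≤-from (0≤δ m) (solve 2 (λ q d → q ⊕ d ⊕ rat 0ℚ ⊜ q ⊕ d) refl q (δ m))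

fromℚ-mono-≺ : ∀ {p q} → p ℚ.< q → fromℚ p ≺ fromℚ q
fromℚ-mono-≺ {p} {q} p<q = ≺-intro (fromℚ p) (fromℚ q) p<q (fromℚ-⊑ p) (fromℚ-⊑ q)

fromℚ-cancel-≼ : ∀ {p q} → fromℚ p ≼ fromℚ q → p ℚ.≤ q
fromℚ-cancel-≼ p≼q = ℚₚ.≮⇒≥ (≼⇒⊁ p≼q ∘ fromℚ-mono-≺)

seq-upper : ∀ x n → x ≼ fromℚ (seq x n ℚ.+ δ n)
seq-upper x n = ≼-intro 1ℚ λ m →
  ℚₚ.≤-trans (⊑-seq x n m) (ℚₚ.+-monoʳ-≤ (seq x n ℚ.+ δ n) (ℚₚ.≤-reflexive (sym (ℚₚ.*-identityˡ (δ m)))))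

seq-lower : ∀ x n → fromℚ (seq x n ℚ.- δ n) ≼ x
seq-lower x n = ≼-intro 1ℚ λ m →
  ℚₚ.≤-trans (⊒-seq x n m) (ℚₚ.+-monoʳ-≤ (seq x m) (ℚₚ.≤-reflexive (sym (ℚₚ.*-identityˡ (δ m)))))

opaque
  unfolding sum

  -- Makes a strict inequality quantitative: the margin `δ k` is what later estimates spend.
  ≺-room : ∀ {x y} → x ≺ y → ∃[ k ] x ∔ fromℚ (δ k) ≺ y
  ≺-room {x} {y} (<⇒≺ (n , x<y)) =
    let k , small = δ-small (gap x<y)
        0≤δk = 0≤δ k
    in k , ≺-intro (x ∔ fromℚ (δ k)) y {seq x n ℚ.+ δ n ℚ.+ δ k} {seq y n ℚ.- δ n}
      (<-from (ℚₚ.+-mono-<-≤ small (0≤δk ⊞ 0≤δk ⊞ 0≤δk))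
        (solve 3 (λ p q d → q ⊕ (d ⊕ d ⊕ (d ⊕ d) ⊕ (rat 0ℚ ⊕ rat 0ℚ ⊕ rat 0ℚ)) ⊜
                         p ⊕ d ⊕ (q ⊖ p ⊕ (d ⊕ d ⊕ d))) refl
          (seq x n ℚ.+ δ n) (seq y n ℚ.- δ n) (δ k)))
      (λ m → ≤-from (⊑-seq x n (suc m) ⊞ δ-antitone (ℕₚ.n≤1+n m))
        (solve 5 (λ x p k d e → p ⊕ k ⊕ d ⊕ (x ⊕ e) ⊜ x ⊕ k ⊕ (p ⊕ e ⊕ d)) refl
          (seq x (suc m)) (seq x n ℚ.+ δ n) (δ k) (δ m) (δ (suc m))))
      (⊒-seq y n)

-- Maximum

infixl 6 _⊔_

opaque
  _⊔_ : ℝ → ℝ → ℝ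
  (x ⊔ y) .seq n       = seq x n ℚ.⊔ seq y n
  (x ⊔ y) .regular m n = ≤-from
    (ℚₚ.⊔-lub (bound (seq x m) (seq x n) _ (regular x m n) (ℚₚ.p≤p⊔q (seq x n) (seq y n)))
              (bound (seq y m) (seq y n) _ (regular y m n) (ℚₚ.p≤q⊔p (seq x n) (seq y n))))
    (solve 3 (λ u v d → d ⊕ u ⊜ u ⊖ v ⊕ (v ⊕ d)) refl
      (seq x m ℚ.⊔ seq y m) (seq x n ℚ.⊔ seq y n) (δ m ℚ.+ δ n))
    where
    bound : ∀ p q r → p ℚ.- q ℚ.≤ δ m ℚ.+ δ n → q ℚ.≤ r → p ℚ.≤ r ℚ.+ (δ m ℚ.+ δ n)
    bound p q r p-q≤ q≤r = ≤-from (p-q≤ ⊞ q≤r)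
      (solve 4 (λ p q r d → r ⊕ d ⊕ (p ⊖ q ⊕ q) ⊜ p ⊕ (d ⊕ r)) refl p q r (δ m ℚ.+ δ n))

  x≼x⊔y : ∀ x y → x ≼ x ⊔ y
  x≼x⊔y x y = pointwise-≼ λ n → ℚₚ.p≤p⊔q (seq x n) (seq y n)

  y≼x⊔y : ∀ x y → y ≼ x ⊔ y
  y≼x⊔y x y = pointwise-≼ λ n → ℚₚ.p≤q⊔p (seq x n) (seq y n)

  -- The strict inequality is witnessed at one index, where the maximum of two rationals is one of
  -- them. For the reals themselves no such choice is possible.
  ≺-⊔ : ∀ {x y z} → z ≺ x ⊔ y → z ≺ x ⊎ z ≺ y
  ≺-⊔ {x} {y} {z} (<⇒≺ (n , z<x⊔y)) =
    [ (λ eq → inj₁ (<⇒≺ (n , subst (λ p → _ ℚ.< p ℚ.- δ n) eq z<x⊔y)))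
    , (λ eq → inj₂ (<⇒≺ (n , subst (λ p → _ ℚ.< p ℚ.- δ n) eq z<x⊔y)))
    ]′ (ℚₚ.⊔-sel (seq x n) (seq y n))

⊔-lub : ∀ {x y z} → x ≼ z → y ≼ z → x ⊔ y ≼ z
⊔-lub x≼z y≼z = ⊀⇒≽ λ z≺x⊔y → [ ≼⇒⊁ x≼z , ≼⇒⊁ y≼z ]′ (≺-⊔ z≺x⊔y)

⊔-cong : ∀ {x y u v} → x ≃ y → u ≃ v → x ⊔ u ≃ y ⊔ v
⊔-cong {x} {y} {u} {v} (x≼y , y≼x) (u≼v , v≼u) =
  ⊔-lub (≼-trans x≼y (x≼x⊔y y v)) (≼-trans u≼v (y≼x⊔y y v)) ,
  ⊔-lub (≼-trans y≼x (x≼x⊔y x u)) (≼-trans v≼u (y≼x⊔y x u))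

-- A point outside all intervals of a cover

increment : (ℚ → ℚ) → ℚ → ℚ → ℚ
increment g u v = g v ℚ.- g u

-- `G N` acts as a primitive: its increment over [u, v] stands for the total length that the first N
-- intervals have inside [u, v], so that the contributions of two halves add by telescoping. `tail`
-- is the convergence of the series, `slack` a shortfall uniform in N.
module Bisection
  (G     : ℕ → ℚ → ℚ)
  (mono  : ∀ {M N u v} → M ℕ.≤ N → u ℚ.≤ v → increment (G M) u v ℚ.≤ increment (G N) u v)
  (tail  : ∀ j → ∃[ M ] ∀ N → M ℕ.≤ N → increment (G N) 0ℚ 1ℚ ℚ.≤ increment (G M) 0ℚ 1ℚ ℚ.+ δ j)
  (slack : ∃[ j ] ∀ N → increment (G N) 0ℚ 1ℚ ℚ.+ δ j ℚ.≤ 1ℚ)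
  where

  record Stage (k : ℕ) : Set where
    field
      left    : ℚ
      0≤left  : 0ℚ ℚ.≤ left
      right≤1 : left ℚ.+ δ k ℚ.≤ 1ℚ
      -- The shortfall must be uniform in N, since no finite part is the whole cover.
      room    : ∃[ j ] ∀ N → increment (G N) left (left ℚ.+ δ k) ℚ.+ δ j ℚ.≤ δ k

  open Stage

  record _⊂_ {k} (T : Stage (suc k)) (S : Stage k) : Set where
    field
      left≤left   : left S ℚ.≤ left T
      right≤right : left T ℚ.+ δ (suc k) ℚ.≤ left S ℚ.+ δ k

  open _⊂_

  stage₀ : Stage 0
  stage₀ = record
    { left    = 0ℚ
    ; 0≤left  = ℚₚ.≤-refl
    ; right≤1 = ℚₚ.≤-reflexive (ℚₚ.+-identityˡ 1ℚ)
    ; room    = slack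
    }

  -- A later term of G exceeds the M-th by at most e on [0, 1], hence on
  -- every subinterval.
  narrow : ∀ {M u v e h} → 0ℚ ℚ.≤ u → u ℚ.≤ v → v ℚ.≤ 1ℚ → 0ℚ ℚ.≤ e →
           (∀ N → M ℕ.≤ N → increment (G N) 0ℚ 1ℚ ℚ.≤ increment (G M) 0ℚ 1ℚ ℚ.+ e) →
           increment (G M) u v ℚ.+ e ℚ.+ e ℚ.≤ h →
           ∀ N → increment (G N) u v ℚ.+ e ℚ.≤ h
  narrow {M} {u} {v} {e} {h} 0≤u u≤v v≤1 0≤e tail-M room-M N =
    [ (λ N≤M → ≤-from (mono N≤M u≤v ⊞ room-M ⊞ 0≤e)
        (solve 4 (λ a b e h → h ⊕ (a ⊕ (b ⊕ e ⊕ e) ⊕ rat 0ℚ) ⊜ a ⊕ e ⊕ (b ⊕ h ⊕ e)) refl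
          (increment (G N) u v) (increment (G M) u v) e h))
    , (λ M≤N → ≤-from (tail-M N M≤N ⊞ mono M≤N 0≤u ⊞ mono M≤N v≤1 ⊞ room-M)
        (solve 10 (λ n₀ nu nv n₁ m₀ mu mv m₁ e h →
            h ⊕ ((n₁ ⊖ n₀) ⊕ (mu ⊖ m₀) ⊕ (m₁ ⊖ mv) ⊕ (mv ⊖ mu ⊕ e ⊕ e)) ⊜
            nv ⊖ nu ⊕ e ⊕ ((m₁ ⊖ m₀) ⊕ e ⊕ (nu ⊖ n₀) ⊕ (n₁ ⊖ nv) ⊕ h)) refl
          (G N 0ℚ) (G N u) (G N v) (G N 1ℚ) (G M 0ℚ) (G M u) (G M v) (G M 1ℚ) e h))
    ]′ (ℕₚ.≤-total N M)

  opaque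
    -- The room `δ j` of the stage is 4 e. Either the left half has length to spare of at least 2 e
    -- at M, or the left half holds more than h - 2 e and the right half has the 2 e to spare. One e
    -- then pays for all terms beyond M, and the other is the room of the next stage.
    bisect : ∀ {k} (S : Stage k) → Σ[ T ∈ Stage (suc k) ] T ⊂ S
    bisect {k} S = [ right-half , left-half ]′ (<⊎≥ (h ℚ.- (e ℚ.+ e)) (increment (G M) c m))
      where
      c m r h e : ℚ
      j M : ℕ
      c = left S
      h = δ (suc k)
      m = c ℚ.+ h
      r = m ℚ.+ h
      j = proj₁ (room S)
      e = δ (suc (suc j))
      M = proj₁ (tail (suc (suc j)))
      r≡ : r ≡ c ℚ.+ δ k
      r≡ = trans (ℚₚ.+-assoc c h h) (cong (c ℚ.+_) (δ-double k))
      0≤h : 0ℚ ℚ.≤ h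
      0≤h = 0≤δ (suc k)
      c≤m : c ℚ.≤ m
      c≤m = ≤-from 0≤h (solve 2 (λ c h → c ⊕ h ⊕ rat 0ℚ ⊜ c ⊕ h) refl c h)
      m≤r : m ℚ.≤ r
      m≤r = ≤-from 0≤h (solve 2 (λ c h → c ⊕ h ⊕ rat 0ℚ ⊜ c ⊕ h) refl m h)
      r≤1 : r ℚ.≤ 1ℚ
      r≤1 = subst (ℚ._≤ 1ℚ) (sym r≡) (right≤1 S)
      δj≡ : δ j ≡ e ℚ.+ e ℚ.+ (e ℚ.+ e)
      δj≡ = sym (δ-quadruple j)
      room-S : increment (G M) c r ℚ.+ (e ℚ.+ e ℚ.+ (e ℚ.+ e)) ℚ.≤ h ℚ.+ h
      room-S = subst₂ ℚ._≤_ (cong₂ (λ p q → increment (G M) c p ℚ.+ q) (sym r≡) δj≡)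
        (sym (δ-double k)) (proj₂ (room S) M)
      left-half : increment (G M) c m ℚ.≤ h ℚ.- (e ℚ.+ e) → Σ[ T ∈ Stage (suc k) ] T ⊂ S
      left-half small = record
        { left    = c
        ; 0≤left  = 0≤left S
        ; right≤1 = ℚₚ.≤-trans m≤r r≤1
        ; room    = suc (suc j) , narrow (0≤left S) c≤m (ℚₚ.≤-trans m≤r r≤1) (0≤δ (suc (suc j)))
                      (proj₂ (tail (suc (suc j))))
                      (≤-from small (solve 3 (λ a e h → h ⊕ a ⊜ a ⊕ e ⊕ e ⊕ (h ⊖ (e ⊕ e))) refl
                        (increment (G M) c m) e h))
        } , record
        { left≤left   = ℚₚ.≤-refl
        ; right≤right = subst (m ℚ.≤_) r≡ m≤r
        }
      right-half : h ℚ.- (e ℚ.+ e) ℚ.< increment (G M) c m → Σ[ T ∈ Stage (suc k) ] T ⊂ S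
      right-half large = record
        { left    = m
        ; 0≤left  = ℚₚ.≤-trans (0≤left S) c≤m
        ; right≤1 = r≤1
        ; room    = suc (suc j) , narrow (ℚₚ.≤-trans (0≤left S) c≤m) m≤r r≤1 (0≤δ (suc (suc j)))
                      (proj₂ (tail (suc (suc j))))
                      (≤-from (room-S ⊞ ℚₚ.<⇒≤ large)
                        (solve 5 (λ gc gm gr e h →
                            h ⊕ (gr ⊖ gc ⊕ (e ⊕ e ⊕ (e ⊕ e)) ⊕ (h ⊖ (e ⊕ e))) ⊜
                            gr ⊖ gm ⊕ e ⊕ e ⊕ (h ⊕ h ⊕ (gm ⊖ gc))) refl
                          (G M c) (G M m) (G M r) e h))
        } , record
        { left≤left   = c≤m
        ; right≤right = ℚₚ.≤-reflexive r≡
        }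

  stage : ∀ k → Stage k
  stage zero    = stage₀
  stage (suc k) = proj₁ (bisect (stage k))

  lefts : ℕ → ℚ
  lefts k = left (stage k)

  lefts-mono : ∀ {m n} → m ℕ.≤ n → lefts m ℚ.≤ lefts n
  lefts-mono = go ∘ ℕₚ.≤⇒≤′
    where
    go : ∀ {m n} → m ℕ.≤′ n → lefts m ℚ.≤ lefts n
    go (ℕ.≤′-reflexive refl) = ℚₚ.≤-refl
    go {n = suc n} (ℕ.≤′-step m≤n) = ℚₚ.≤-trans (go m≤n) (left≤left (proj₂ (bisect (stage n))))

  rights-antitone : ∀ {m n} → m ℕ.≤ n → lefts n ℚ.+ δ n ℚ.≤ lefts m ℚ.+ δ m
  rights-antitone = go ∘ ℕₚ.≤⇒≤′
    where
    go : ∀ {m n} → m ℕ.≤′ n → lefts n ℚ.+ δ n ℚ.≤ lefts m ℚ.+ δ m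
    go (ℕ.≤′-reflexive refl) = ℚₚ.≤-refl
    go {n = suc n} (ℕ.≤′-step m≤n) = ℚₚ.≤-trans (right≤right (proj₂ (bisect (stage n)))) (go m≤n)

  limit : ℝ
  limit .seq = lefts
  limit .regular m n =
    [ (λ m≤n → ≤-from (lefts-mono m≤n ⊞ 0≤δ m ⊞ 0≤δ n)
        (solve 4 (λ x y d e → d ⊕ e ⊕ (x ⊕ rat 0ℚ ⊕ rat 0ℚ) ⊜ x ⊖ y ⊕ (y ⊕ d ⊕ e)) refl
          (lefts m) (lefts n) (δ m) (δ n)))
    , (λ n≤m → ≤-from (rights-antitone n≤m ⊞ 0≤δ m ⊞ 0≤δ m)
        (solve 4 (λ x y d e → d ⊕ e ⊕ (x ⊕ d ⊕ rat 0ℚ ⊕ rat 0ℚ) ⊜ x ⊖ y ⊕ (y ⊕ e ⊕ d ⊕ d)) refl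
          (lefts m) (lefts n) (δ m) (δ n)))
    ]′ (ℕₚ.≤-total m n)

  limit∈𝕀 : 0ℝ ≼ limit × limit ≼ 1ℝ
  limit∈𝕀 = pointwise-≼ (λ k → 0≤left (stage k)) , pointwise-≼ λ k →
    ≤-from (right≤1 (stage k) ⊞ 0≤δ k)
      (solve 2 (λ x d → rat 1ℚ ⊕ (x ⊕ d ⊕ rat 0ℚ) ⊜ x ⊕ (rat 1ℚ ⊕ d)) refl (lefts k) (δ k))

  limit-increment : ∀ k N → increment (G N) (lefts k) (lefts k ℚ.+ δ k) ℚ.< δ k
  limit-increment k N = let j , room-N = room (stage k) in
    <-from (ℚₚ.+-mono-<-≤ (0<δ j) (room-N N))
      (solve 3 (λ a d e → d ⊕ (rat 0ℚ ⊕ (a ⊕ e)) ⊜ a ⊕ (e ⊕ d)) refl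
        (increment (G N) (lefts k) (lefts k ℚ.+ δ k)) (δ k) (δ j))

fromℚ-+-≼ : ∀ {p q r s} → p ℚ.+ q ℚ.≤ r ℚ.+ s → fromℚ p ∔ fromℚ q ≼ fromℚ r ∔ fromℚ s
fromℚ-+-≼ {p} {q} {r} {s} p+q≤r+s =
  ≼-trans (proj₂ (fromℚ-+ p q)) (≼-trans (fromℚ-mono-≼ p+q≤r+s) (proj₁ (fromℚ-+ r s)))

-- The increments of clip p q are the lengths of the intersections with [p, q].
clip : ℚ → ℚ → ℚ → ℚ
clip p q z = p ℚ.⊔ (z ℚ.⊓ q)

clip-mono : ∀ p q {u v} → u ℚ.≤ v → clip p q u ℚ.≤ clip p q v
clip-mono p q u≤v = ℚₚ.⊔-monoʳ-≤ p (ℚₚ.⊓-monoˡ-≤ q u≤v)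

p≤clip : ∀ p q z → p ℚ.≤ clip p q z
p≤clip p q z = ℚₚ.p≤p⊔q p (z ℚ.⊓ q)

clip≤q : ∀ {p q} z → p ℚ.≤ q → clip p q z ℚ.≤ q
clip≤q {p} {q} z p≤q = ℚₚ.⊔-lub p≤q (ℚₚ.p⊓q≤q z q)

clip-id : ∀ {p q z} → p ℚ.≤ z → z ℚ.≤ q → clip p q z ≡ z
clip-id {p} {q} {z} p≤z z≤q = trans (cong (p ℚ.⊔_) (ℚₚ.p≤q⇒p⊓q≡p z≤q)) (ℚₚ.p≤q⇒p⊔q≡q p≤z)

∑ : (ℕ → ℚ) → ℕ → ℚ
∑ f zero    = 0ℚ
∑ f (suc n) = ∑ f n ℚ.+ f n

module Clips (p q : ℕ → ℚ) (p≤q : ∀ n → p n ℚ.≤ q n) where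

  width : ℕ → ℚ
  width n = q n ℚ.- p n

  G : ℕ → ℚ → ℚ
  G N z = ∑ (λ n → clip (p n) (q n) z) N

  G-mono : ∀ {M N u v} → M ℕ.≤ N → u ℚ.≤ v → increment (G M) u v ℚ.≤ increment (G N) u v
  G-mono {u = u} {v} M≤N u≤v = go (ℕₚ.≤⇒≤′ M≤N)
    where
    go : ∀ {M N} → M ℕ.≤′ N → increment (G M) u v ℚ.≤ increment (G N) u v
    go (ℕ.≤′-reflexive refl) = ℚₚ.≤-refl
    go {M} {suc N} (ℕ.≤′-step M≤N) = ≤-from (go M≤N ⊞ clip-mono (p N) (q N) u≤v)
      (solve 5 (λ a b c x y → b ⊕ y ⊖ (c ⊕ x) ⊕ (a ⊕ x) ⊜ a ⊕ (b ⊖ c ⊕ y)) refl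
        (increment (G M) u v) (G N v) (G N u) (clip (p N) (q N) u) (clip (p N) (q N) v))

  -- Each later interval adds to [0, 1] at most its full width, so the convergence of the widths
  -- controls the increments.
  G-tail : ∀ {M N} → M ℕ.≤ N →
           increment (G N) 0ℚ 1ℚ ℚ.+ ∑ width M ℚ.≤ increment (G M) 0ℚ 1ℚ ℚ.+ ∑ width N
  G-tail = go ∘ ℕₚ.≤⇒≤′
    where
    go : ∀ {M N} → M ℕ.≤′ N →
         increment (G N) 0ℚ 1ℚ ℚ.+ ∑ width M ℚ.≤ increment (G M) 0ℚ 1ℚ ℚ.+ ∑ width N
    go (ℕ.≤′-reflexive refl) = ℚₚ.≤-refl
    go {M} {suc N} (ℕ.≤′-step M≤N) =
      ≤-from (go M≤N ⊞ clip≤q 1ℚ (p≤q N) ⊞ p≤clip (p N) (q N) 0ℚ)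
      (solve 9 (λ a b c d e x y p q →
          a ⊕ (e ⊕ (q ⊖ p)) ⊕ (b ⊖ c ⊕ d ⊕ y ⊕ p) ⊜ b ⊕ y ⊖ (c ⊕ x) ⊕ d ⊕ (a ⊕ e ⊕ q ⊕ x)) refl
        (increment (G M) 0ℚ 1ℚ) (G N 1ℚ) (G N 0ℚ) (∑ width M) (∑ width N)
        (clip (p N) (q N) 0ℚ) (clip (p N) (q N) 1ℚ) (p N) (q N))

  G-total : ∀ N → increment (G N) 0ℚ 1ℚ ℚ.≤ ∑ width N
  G-total N = ≤-from (G-tail {0} {N} ℕ.z≤n)
    (solve 2 (λ a b → b ⊕ (a ⊕ rat 0ℚ) ⊜ a ⊕ ((rat 0ℚ ⊖ rat 0ℚ) ⊕ b)) refl
      (increment (G N) 0ℚ 1ℚ) (∑ width N))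

  -- Inside [p n, q n] clipping is the identity, so the n-th interval alone contributes v - u. The
  -- index is `suc n` because `∑` stops before its bound.
  G-full : ∀ {u v} n → p n ℚ.≤ u → u ℚ.≤ v → v ℚ.≤ q n → v ℚ.- u ℚ.≤ increment (G (suc n)) u v
  G-full {u} {v} n p≤u u≤v v≤q = ≤-from (G-mono {0} {n} ℕ.z≤n u≤v)
    (trans (cong₂ (λ x y → G n v ℚ.+ y ℚ.- (G n u ℚ.+ x) ℚ.+ (0ℚ ℚ.- 0ℚ))
             (clip-id p≤u (ℚₚ.≤-trans u≤v v≤q)) (clip-id (ℚₚ.≤-trans p≤u u≤v) v≤q))
      (solve 4 (λ u v b c → b ⊕ v ⊖ (c ⊕ u) ⊕ (rat 0ℚ ⊖ rat 0ℚ) ⊜ v ⊖ u ⊕ (b ⊖ c)) refl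
        u v (G n v) (G n u)))

-- Series of lengths and their rational enlargements

partialSum-suc : ∀ f n → partialSum f (suc n) ≡ partialSum f n ∔ f n
partialSum-suc f n = +≡∔ (partialSum f n) (f n)

HasSum⇒≺ : ∀ {f s} → HasSum f s → ∀ i → ∃[ M ] ∀ n → M ℕ.≤ n →
           s ∸ fromℚ (δ i) ≺ partialSum f n × partialSum f n ≺ s ∔ fromℚ (δ i)
HasSum⇒≺ {f} {s} sums i =
  let M , near = sums (fromℚ (δ i)) (≺⇒< (fromℚ-mono-≺ (0<δ i))) in
  M , λ n M≤n →
    subst (_≺ partialSum f n) (-≡∸ s (fromℚ (δ i))) (<⇒≺ (proj₁ (near n M≤n))) ,
    subst (partialSum f n ≺_) (+≡∔ s (fromℚ (δ i))) (<⇒≺ (proj₂ (near n M≤n)))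

partialSum-mono : ∀ {f} → (∀ n → 0ℝ ≼ f n) → ∀ {m n} → m ℕ.≤ n → partialSum f m ≼ partialSum f n
partialSum-mono {f} 0≼f = go ∘ ℕₚ.≤⇒≤′
  where
  go : ∀ {m n} → m ℕ.≤′ n → partialSum f m ≼ partialSum f n
  go (ℕ.≤′-reflexive refl) = ≼-refl
  go {m} {suc n} (ℕ.≤′-step m≤n) = subst (partialSum f m ≼_) (sym (partialSum-suc f n))
    (≼-from (+-mono-≼ (go m≤n) (0≼f n))
      (solveℝ 3 (λ a b c → b ⊕ c ⊕ (a ⊕ rat 0ℚ) ⊜ a ⊕ (b ⊕ c)) refl
        (partialSum f m) (partialSum f n) (f n)))

partialSum-≼ : ∀ {f s} → (∀ n → 0ℝ ≼ f n) → HasSum f s → ∀ n → partialSum f n ≼ s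
partialSum-≼ {f} {s} 0≼f sums n = ⊀⇒≽ λ s≺S →
  let i , s+δ≺S = ≺-room s≺S
      M , near = HasSum⇒≺ {s = s} sums i
  in ≺-asym s+δ≺S (≼-≺-trans (partialSum-mono 0≼f (ℕₚ.m≤n⊔m M n))
                             (proj₂ (near (M ℕ.⊔ n) (ℕₚ.m≤m⊔n M n))))

0≼len : ∀ I → 0ℝ ≼ len I
0≼len I = subst (0ℝ ≼_) (sym (-≡∸ (hi I) (lo I)))
  (≼-from (≤⇒≼ (lo≤hi I)) (solveℝ 2 (λ l h → h ⊖ l ⊕ l ⊜ rat 0ℚ ⊕ h) refl (lo I) (hi I)))

-- The n-th interval is enlarged to rational endpoints at a cost of at most
-- δ (1 + n + j), which adds up to δ j over all n.
module RationalCover (I : ℕ → OpenInterval) (j : ℕ) where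

  precision : ℕ → ℕ
  -- Each end moves by at most 2 δ at this precision, and 4 δ (3 + n + j) = δ (1 + n + j).
  precision n = 3 ℕ.+ (n ℕ.+ j)

  p q : ℕ → ℚ
  p n = seq (lo (I n)) (precision n) ℚ.- δ (precision n)
  q n = seq (hi (I n)) (precision n) ℚ.+ δ (precision n)

  p≼lo : ∀ n → fromℚ (p n) ≼ lo (I n)
  p≼lo n = seq-lower (lo (I n)) (precision n)

  hi≼q : ∀ n → hi (I n) ≼ fromℚ (q n)
  hi≼q n = seq-upper (hi (I n)) (precision n)

  p≤q : ∀ n → p n ℚ.≤ q n
  p≤q n = fromℚ-cancel-≼ (≼-trans (p≼lo n) (≼-trans (≤⇒≼ (lo≤hi (I n))) (hi≼q n)))

  open Clips p q p≤q public

  S : ℕ → ℝ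
  S = partialSum (λ n → len (I n))

  width≼ : ∀ n → fromℚ (width n) ≼ len (I n) ∔ fromℚ (δ (suc (n ℕ.+ j)))
  width≼ n = subst (λ l → fromℚ (width n) ≼ l ∔ fromℚ (δ (suc (n ℕ.+ j)))) (sym (-≡∸ (hi (I n)) (lo (I n))))
    (≼-from
      (+-mono-≼ (+-mono-≼ (seq-lower (hi (I n)) k) (seq-upper (lo (I n)) k))
        (fromℚ-+-≼ {width n} (ℚₚ.≤-reflexive rational)))
      (solveℝ 6 (λ u v l h w d → h ⊖ l ⊕ d ⊕ (u ⊕ l ⊕ (w ⊕ v)) ⊜ w ⊕ (h ⊕ v ⊕ (d ⊕ u))) refl
        (fromℚ (seq (hi (I n)) k ℚ.- δ k)) (fromℚ (seq (lo (I n)) k ℚ.+ δ k)) (lo (I n)) (hi (I n))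
        (fromℚ (width n)) (fromℚ (δ (suc (n ℕ.+ j))))))
    where
    k = precision n
    δ≡ : δ (suc (n ℕ.+ j)) ≡ δ k ℚ.+ δ k ℚ.+ (δ k ℚ.+ δ k)
    δ≡ = sym (δ-quadruple (suc (n ℕ.+ j)))
    rational : width n ℚ.+ (seq (lo (I n)) k ℚ.+ δ k) ≡ δ (suc (n ℕ.+ j)) ℚ.+ (seq (hi (I n)) k ℚ.- δ k)
    rational = trans
      (solve 3 (λ l h d → h ⊕ d ⊖ (l ⊖ d) ⊕ (l ⊕ d) ⊜ d ⊕ d ⊕ (d ⊕ d) ⊕ (h ⊖ d)) refl
        (seq (lo (I n)) k) (seq (hi (I n)) k) (δ k))
      (cong (ℚ._+ (seq (hi (I n)) k ℚ.- δ k)) (sym δ≡))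

  -- The first N enlargements may cost `δ j - δ (N + j)` together. With the unspent `δ (N + j)`
  -- added, the excess over `S N` can only decrease.
  W+δ : ℕ → ℚ
  W+δ N = ∑ width N ℚ.+ δ (N ℕ.+ j)

  W+δ-S-antitone : ∀ {M N} → M ℕ.≤ N → fromℚ (W+δ N) ∔ S M ≼ fromℚ (W+δ M) ∔ S N
  W+δ-S-antitone = go ∘ ℕₚ.≤⇒≤′
    where
    go : ∀ {M N} → M ℕ.≤′ N → fromℚ (W+δ N) ∔ S M ≼ fromℚ (W+δ M) ∔ S N
    go (ℕ.≤′-reflexive refl) = ≼-refl
    go {M} {suc N} (ℕ.≤′-step M≤N) = subst (λ z → fromℚ (W+δ (suc N)) ∔ S M ≼ fromℚ (W+δ M) ∔ z)
      (sym (partialSum-suc (λ n → len (I n)) N))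
      (≼-from (+-mono-≼ (+-mono-≼ (go M≤N) (width≼ N)) (fromℚ-+-≼ {W+δ (suc N)} rational))
        (solveℝ 8 (λ a₁ a a₀ s₀ s w l d → a₀ ⊕ (s ⊕ l) ⊕ (a ⊕ s₀ ⊕ w ⊕ (a₁ ⊕ d)) ⊜
                                          a₁ ⊕ s₀ ⊕ (a₀ ⊕ s ⊕ (l ⊕ d) ⊕ (a ⊕ w))) refl
          (fromℚ (W+δ (suc N))) (fromℚ (W+δ N)) (fromℚ (W+δ M)) (S M) (S N)
          (fromℚ (width N)) (len (I N)) (fromℚ (δ (suc (N ℕ.+ j))))))
      where
      rational : W+δ (suc N) ℚ.+ δ (suc (N ℕ.+ j)) ℚ.≤ W+δ N ℚ.+ width N
      rational = ≤-from (ℚₚ.≤-reflexive (δ-double (N ℕ.+ j)))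
        (solve 4 (λ W w d e → W ⊕ e ⊕ w ⊕ (d ⊕ d) ⊜ W ⊕ w ⊕ d ⊕ d ⊕ e) refl
          (∑ width N) (width N) (δ (suc (N ℕ.+ j))) (δ (N ℕ.+ j)))

  module _ {s : ℝ} (sums : HasSum (λ n → len (I n)) s) where

    widths-total : ∀ N → fromℚ (∑ width N) ≼ s ∔ fromℚ (δ j)
    widths-total N = ≼-from
      (+-mono-≼ (+-mono-≼ (W+δ-S-antitone {0} {N} ℕ.z≤n) (partialSum-≼ {s = s} (λ n → 0≼len (I n)) sums N))
        (+-mono-≼ (fromℚ-mono-≼ W≤) (fromℚ-mono-≼ (ℚₚ.≤-reflexive (ℚₚ.+-identityˡ (δ j))))))
      (solveℝ 6 (λ a a₀ w S s d → s ⊕ d ⊕ (a ⊕ rat 0ℚ ⊕ S ⊕ (w ⊕ a₀)) ⊜ w ⊕ (a₀ ⊕ S ⊕ s ⊕ (a ⊕ d))) refl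
        (fromℚ (W+δ N)) (fromℚ (W+δ 0)) (fromℚ (∑ width N)) (S N) s (fromℚ (δ j)))
      where
      W≤ : ∑ width N ℚ.≤ W+δ N
      W≤ = ≤-from (0≤δ (N ℕ.+ j)) (solve 2 (λ w d → w ⊕ d ⊕ rat 0ℚ ⊜ w ⊕ d) refl (∑ width N) (δ (N ℕ.+ j)))

    widths-tail : ∀ i → ∃[ K ] ∀ {M N} → K ℕ.≤ M → M ℕ.≤ N → ∑ width N ℚ.≤ ∑ width M ℚ.+ δ i
    widths-tail i = K ℕ.⊔ k , λ {M} {N} K⊔k≤M M≤N →
      let K≤M = ℕₚ.≤-trans (ℕₚ.m≤m⊔n K k) K⊔k≤M
          k≤M = ℕₚ.≤-trans (ℕₚ.m≤n⊔m K k) K⊔k≤M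
          real : fromℚ (W+δ N) ≼ fromℚ (W+δ M ℚ.+ (δ k ℚ.+ δ k))
          real = ≼-from
            (+-mono-≼ (+-mono-≼ (W+δ-S-antitone M≤N) (proj₂ (fromℚ-+ (W+δ M) (δ k ℚ.+ δ k))))
              (+-mono-≼ (+-mono-≼ (≺⇒≼ (proj₁ (near M K≤M))) (≺⇒≼ (proj₂ (near N (ℕₚ.≤-trans K≤M M≤N)))))
                        (proj₂ (fromℚ-+ (δ k) (δ k)))))
            (solveℝ 8 (λ a b c S T s d e → c ⊕ (a ⊕ S ⊕ (b ⊕ e) ⊕ (s ⊖ d ⊕ T ⊕ (d ⊕ d))) ⊜
                                           a ⊕ (b ⊕ T ⊕ c ⊕ (S ⊕ (s ⊕ d) ⊕ e))) refl
              (fromℚ (W+δ N)) (fromℚ (W+δ M)) (fromℚ (W+δ M ℚ.+ (δ k ℚ.+ δ k))) (S M) (S N) s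
              (fromℚ (δ k)) (fromℚ (δ k ℚ.+ δ k)))
      in ≤-from (fromℚ-cancel-≼ real ⊞ δ-antitone (ℕₚ.≤-trans k≤M (ℕₚ.m≤m+n M j)) ⊞ 0≤δ (N ℕ.+ j) ⊞ 0≤δ k
                 ⊞ ℚₚ.≤-reflexive δ≡)
        (solve 6 (λ W V d e f g → V ⊕ g ⊕ (W ⊕ f ⊕ e ⊕ rat 0ℚ ⊕ rat 0ℚ ⊕ (d ⊕ d ⊕ (d ⊕ d))) ⊜
                                  W ⊕ (V ⊕ e ⊕ (d ⊕ d) ⊕ d ⊕ f ⊕ d ⊕ g)) refl
          (∑ width N) (∑ width M) (δ k) (δ (M ℕ.+ j)) (δ (N ℕ.+ j)) (δ i))
      where
      -- Quarters of `δ i`: two for the distances of `S M` and `S N` from s, one for `δ (M + j)`,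
      -- whence the demand `k ≤ M`, and one to spare.
      k = 2 ℕ.+ i
      K = proj₁ (HasSum⇒≺ {s = s} sums k)
      near = proj₂ (HasSum⇒≺ {s = s} sums k)
      δ≡ : δ k ℚ.+ δ k ℚ.+ (δ k ℚ.+ δ k) ≡ δ i
      δ≡ = δ-quadruple i

  -- The bounds have the shape of the ends of bisection stages: for the limit, `seq x m` is a left
  -- end and `seq x m′ + δ m′` a right end, so the stage at the larger index lies in [p n, q n].
  capture : ∀ {x n} → x ∈ contains (I n) →
            ∃[ m ] ∃[ m′ ] p n ℚ.≤ seq x m × seq x m′ ℚ.+ δ m′ ℚ.≤ q n
  capture {x} {n} ((m , lo<x) , (m′ , x<hi)) = m , m′ ,
    ≤-from (p≤ ⊞ ℚₚ.<⇒≤ lo<x ⊞ 0≤δ m)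
      (solve 4 (λ p x l d → x ⊕ (p ⊕ (l ⊕ d) ⊕ rat 0ℚ) ⊜ p ⊕ (l ⊕ d ⊕ (x ⊖ d) ⊕ d)) refl
        (p n) (seq x m) (seq (lo (I n)) m) (δ m)) ,
    ℚₚ.≤-trans (ℚₚ.<⇒≤ x<hi) ≤q
    where
    p≤ : p n ℚ.≤ seq (lo (I n)) m ℚ.+ δ m
    p≤ = fromℚ-cancel-≼ (≼-trans (p≼lo n) (seq-upper (lo (I n)) m))
    ≤q : seq (hi (I n)) m′ ℚ.- δ m′ ℚ.≤ q n
    ≤q = fromℚ-cancel-≼ (≼-trans (seq-lower (hi (I n)) m′) (hi≼q n))

-- Two covers of total length below 1 miss a common point

module Uncovered {I J : ℕ → OpenInterval} {s t : ℝ}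
  (sumI : HasSum (λ n → len (I n)) s) (sumJ : HasSum (λ n → len (J n)) t)
  (s+t≺1 : s ∔ t ≺ 1ℝ) where

  private
    k j : ℕ
    k = proj₁ (≺-room s+t≺1)
    -- A quarter of the shortfall `δ k` pays for each of the two enlargements, and a third quarter
    -- becomes the slack of the bisection.
    j = 2 ℕ.+ k
    module 𝒜 = RationalCover I j
    module ℬ = RationalCover J j

  G : ℕ → ℚ → ℚ
  G N z = 𝒜.G N z ℚ.+ ℬ.G N z

  increment-G : ∀ N u v → increment (G N) u v ≡ increment (𝒜.G N) u v ℚ.+ increment (ℬ.G N) u v
  increment-G N u v = solve 4 (λ a b c d → b ⊕ d ⊖ (a ⊕ c) ⊜ b ⊖ a ⊕ (d ⊖ c)) refl
    (𝒜.G N u) (𝒜.G N v) (ℬ.G N u) (ℬ.G N v)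

  mono : ∀ {M N u v} → M ℕ.≤ N → u ℚ.≤ v → increment (G M) u v ℚ.≤ increment (G N) u v
  mono {M} {N} {u} {v} M≤N u≤v = subst₂ ℚ._≤_ (sym (increment-G M u v)) (sym (increment-G N u v))
    (𝒜.G-mono M≤N u≤v ⊞ ℬ.G-mono M≤N u≤v)

  tail : ∀ i → ∃[ M ] ∀ N → M ℕ.≤ N → increment (G N) 0ℚ 1ℚ ℚ.≤ increment (G M) 0ℚ 1ℚ ℚ.+ δ i
  tail i =
    let K  , tailA = 𝒜.widths-tail {s} sumI (suc i)
        K′ , tailB = ℬ.widths-tail {t} sumJ (suc i)
        M = K ℕ.⊔ K′
    in M , λ N M≤N → subst₂ (λ x y → x ℚ.≤ y ℚ.+ δ i)
        (sym (increment-G N 0ℚ 1ℚ)) (sym (increment-G M 0ℚ 1ℚ))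
      (≤-from (𝒜.G-tail M≤N ⊞ ℬ.G-tail M≤N ⊞ tailA (ℕₚ.m≤m⊔n K K′) M≤N ⊞ tailB (ℕₚ.m≤n⊔m K K′) M≤N
               ⊞ ℚₚ.≤-reflexive (δ-double i))
        (solve 10 (λ a a′ b b′ v v′ w w′ d e →
            a′ ⊕ b′ ⊕ e ⊕ (a ⊕ v′ ⊕ (b ⊕ w′) ⊕ v ⊕ w ⊕ (d ⊕ d)) ⊜
            a ⊕ b ⊕ (a′ ⊕ v ⊕ (b′ ⊕ w) ⊕ (v′ ⊕ d) ⊕ (w′ ⊕ d) ⊕ e)) refl
          (increment (𝒜.G N) 0ℚ 1ℚ) (increment (𝒜.G M) 0ℚ 1ℚ)
          (increment (ℬ.G N) 0ℚ 1ℚ) (increment (ℬ.G M) 0ℚ 1ℚ)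
          (∑ 𝒜.width N) (∑ 𝒜.width M) (∑ ℬ.width N) (∑ ℬ.width M) (δ (suc i)) (δ i)))

  slack : ∃[ j ] ∀ N → increment (G N) 0ℚ 1ℚ ℚ.+ δ j ℚ.≤ 1ℚ
  slack = j , λ N → ≤-from
    (𝒜.G-total N ⊞ ℬ.G-total N ⊞ fromℚ-cancel-≼ (total N) ⊞ ℚₚ.≤-reflexive δ≡ ⊞ 0≤δ j)
    (solve 8 (λ a a′ b b′ v w d e →
        rat 1ℚ ⊕ (a′ ⊖ a ⊕ (b′ ⊖ b) ⊕ (v ⊕ w ⊕ e) ⊕ (d ⊕ d ⊕ (d ⊕ d)) ⊕ rat 0ℚ) ⊜
        a′ ⊕ b′ ⊖ (a ⊕ b) ⊕ d ⊕ (v ⊕ w ⊕ (rat 1ℚ ⊕ (d ⊕ d)) ⊕ e ⊕ d)) refl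
      (𝒜.G N 0ℚ) (𝒜.G N 1ℚ) (ℬ.G N 0ℚ) (ℬ.G N 1ℚ) (∑ 𝒜.width N) (∑ ℬ.width N) (δ j) (δ k))
    where
    δ≡ : δ j ℚ.+ δ j ℚ.+ (δ j ℚ.+ δ j) ≡ δ k
    δ≡ = δ-quadruple k
    total : ∀ N → fromℚ (∑ 𝒜.width N ℚ.+ ∑ ℬ.width N ℚ.+ δ k) ≼ fromℚ (1ℚ ℚ.+ (δ j ℚ.+ δ j))
    total N = ≼-trans (proj₁ (fromℚ-+ (∑ 𝒜.width N ℚ.+ ∑ ℬ.width N) (δ k)))
      (≼-trans (≼-from
        (+-mono-≼ (+-mono-≼ (𝒜.widths-total {s} sumI N) (ℬ.widths-total {t} sumJ N))
          (+-mono-≼ (proj₁ (fromℚ-+ (∑ 𝒜.width N) (∑ ℬ.width N)))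
            (+-mono-≼ (≺⇒≼ (proj₂ (≺-room s+t≺1))) (proj₂ (fromℚ-+ (δ j) (δ j))))))
        (solveℝ 8 (λ v w c s t d e f →
            rat 1ℚ ⊕ f ⊕ (v ⊕ w ⊕ (c ⊕ (s ⊕ t ⊕ e ⊕ (d ⊕ d)))) ⊜
            c ⊕ e ⊕ (s ⊕ d ⊕ (t ⊕ d) ⊕ (v ⊕ w ⊕ (rat 1ℚ ⊕ f)))) refl
          (fromℚ (∑ 𝒜.width N)) (fromℚ (∑ ℬ.width N)) (fromℚ (∑ 𝒜.width N ℚ.+ ∑ ℬ.width N)) s t
          (fromℚ (δ j)) (fromℚ (δ k)) (fromℚ (δ j ℚ.+ δ j))))
        (proj₂ (fromℚ-+ 1ℚ (δ j ℚ.+ δ j))))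

  open Bisection G mono tail slack public using (limit; limit∈𝕀)
  open Bisection G mono tail slack using (lefts-mono; rights-antitone; limit-increment)

  -- An interval around the limit would contain a whole stage of the bisection.
  too-long : ∀ {m m′ p q} N → (∀ {u v} → p ℚ.≤ u → u ℚ.≤ v → v ℚ.≤ q → v ℚ.- u ℚ.≤ increment (G N) u v) →
             ¬ (p ℚ.≤ seq limit m × seq limit m′ ℚ.+ δ m′ ℚ.≤ q)
  too-long {m} {m′} N full (p≤ , ≤q) =
    ℚₚ.<-irrefl refl (ℚₚ.≤-<-trans (full
      (ℚₚ.≤-trans p≤ (lefts-mono (ℕₚ.m≤m⊔n m m′)))
      (≤-from (0≤δ i) (solve 2 (λ c d → c ⊕ d ⊕ rat 0ℚ ⊜ c ⊕ d) refl c (δ i)))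
      (ℚₚ.≤-trans (rights-antitone (ℕₚ.m≤n⊔m m m′)) ≤q))
      (subst (increment (G N) c (c ℚ.+ δ i) ℚ.<_)
        (solve 2 (λ c d → d ⊜ c ⊕ d ⊖ c) refl c (δ i)) (limit-increment i N)))
    where
    i = m ℕ.⊔ m′
    c = seq limit i

  limit∉I : ∀ n → ¬ (limit ∈ contains (I n))
  limit∉I n x∈I = let m , m′ , bounds = 𝒜.capture {limit} {n} x∈I in
    too-long {m} {m′} (suc n) (λ {u} {v} p≤u u≤v v≤q → subst (v ℚ.- u ℚ.≤_) (sym (increment-G (suc n) u v))
      (≤-from (𝒜.G-full n p≤u u≤v v≤q ⊞ ℬ.G-mono {0} {suc n} ℕ.z≤n u≤v)
        (solve 3 (λ a b w → a ⊕ b ⊕ (w ⊕ (rat 0ℚ ⊖ rat 0ℚ)) ⊜ w ⊕ (a ⊕ b)) refl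
          (increment (𝒜.G (suc n)) u v) (increment (ℬ.G (suc n)) u v) (v ℚ.- u)))) bounds

  limit∉J : ∀ n → ¬ (limit ∈ contains (J n))
  limit∉J n x∈J = let m , m′ , bounds = ℬ.capture {limit} {n} x∈J in
    too-long {m} {m′} (suc n) (λ {u} {v} p≤u u≤v v≤q → subst (v ℚ.- u ℚ.≤_) (sym (increment-G (suc n) u v))
      (≤-from (ℬ.G-full n p≤u u≤v v≤q ⊞ 𝒜.G-mono {0} {suc n} ℕ.z≤n u≤v)
        (solve 3 (λ a b w → a ⊕ b ⊕ (w ⊕ (rat 0ℚ ⊖ rat 0ℚ)) ⊜ w ⊕ (b ⊕ a)) refl
          (increment (𝒜.G (suc n)) u v) (increment (ℬ.G (suc n)) u v) (v ℚ.- u)))) bounds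

cover-totals : ∀ {E s t} → CoverTotal E s → CoverTotal (𝕀 ∖ E) t → 1ℝ ≼ s ∔ t
cover-totals {s = s} {t} (I , covers-E , sumI) (J , covers-𝕀∖E , sumJ) = ⊀⇒≽ λ s+t≺1 →
  let open Uncovered {I} {J} {s} {t} sumI sumJ s+t≺1
      0≼x , x≼1 = limit∈𝕀
      x∉E = λ x∈E → let n , x∈I = covers-E {limit} x∈E in limit∉I n x∈I
      n , x∈J = covers-𝕀∖E {limit} ((≼⇒≤ 0≼x , ≼⇒≤ x≼1) , x∉E)
  in limit∉J n x∈J

-- Measures of a⁰ ∩ b¹ and 𝕀 ∖ a⁰

0ℝ≺δ : ∀ k → 0ℝ ≺ fromℚ (δ k)
0ℝ≺δ k = fromℚ-mono-≺ (0<δ k)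

≺-∔δ : ∀ x k → x ≺ x ∔ fromℚ (δ k)
≺-∔δ x k = ≺-from (0ℝ≺δ k) (solveℝ 2 (λ x d → x ⊕ d ⊕ rat 0ℚ ⊜ x ⊕ d) refl x (fromℚ (δ k)))

∸δ-≺ : ∀ x k → x ∸ fromℚ (δ k) ≺ x
∸δ-≺ x k = ≺-from (0ℝ≺δ k) (solveℝ 2 (λ x d → x ⊕ rat 0ℚ ⊜ x ⊖ d ⊕ d) refl x (fromℚ (δ k)))

≼⇒≺∔δ : ∀ {x y} k → x ≼ y → x ≺ y ∔ fromℚ (δ k)
≼⇒≺∔δ {x} {y} k x≼y = ≼-≺-trans x≼y (≺-∔δ y k)

≼⇒∸δ≺ : ∀ {x y} k → x ≼ y → x ∸ fromℚ (δ k) ≺ y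
≼⇒∸δ≺ {x} k x≼y = ≺-≼-trans (∸δ-≺ x k) x≼y

δ≺ε : ∀ {ε} → 0ℝ < ε → ∃[ k ] fromℚ (δ k) ≺ ε
δ≺ε {ε} 0<ε = let k , 0+δ≺ε = ≺-room {0ℝ} {ε} (<⇒≺ 0<ε) in
  k , ≺-from 0+δ≺ε (solveℝ 2 (λ d e → e ⊕ (rat 0ℚ ⊕ d) ⊜ d ⊕ e) refl (fromℚ (δ k)) ε)

Attains : Pred ℝ _ → ℝ → Set
Attains P m = ∀ k → ∃[ t ] t ∈ P × t ≼ m ∔ fromℚ (δ k)

-- The lower bound for P comes from approximations in Q: 1 ≤ t + t′ ≤ t + m′ + δ k and m + m′ ≤ 1
-- give m ≤ t + δ k for every k.
isInfimum : ∀ {P Q m m′} → (∀ {t t′} → t ∈ P → t′ ∈ Q → 1ℝ ≼ t ∔ t′) → m ∔ m′ ≼ 1ℝ →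
            Attains P m → Attains Q m′ → IsInfimum P m
isInfimum {P} {Q} {m} {m′} 1≼t+t′ m+m′≼1 attains-m attains-m′ = lower , approached
  where
  lower : ∀ t → t ∈ P → m ≤ t
  lower t t∈P t<m =
    let k , t+δ≺m = ≺-room {t} {m} (<⇒≺ t<m)
        t′ , t′∈Q , t′≼ = attains-m′ k
    in ≼⇒⊁ (+-mono-≼ (1≼t+t′ t∈P t′∈Q) (+-mono-≼ t′≼ m+m′≼1))
         (≺-from t+δ≺m (solveℝ 5 (λ t t′ m m′ d →
            rat 1ℚ ⊕ (t′ ⊕ (m ⊕ m′)) ⊕ (t ⊕ d) ⊜ t ⊕ t′ ⊕ (m′ ⊕ d ⊕ rat 1ℚ) ⊕ m) refl
            t t′ m m′ (fromℚ (δ k))))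
  approached : ∀ ε → 0ℝ < ε → ∃[ t ] t ∈ P × t < m + ε
  approached ε 0<ε =
    let k , δ≺ = δ≺ε {ε} 0<ε
        t , t∈P , t≼ = attains-m k
    in t , t∈P , ≺⇒< (subst (t ≺_) (sym (+≡∔ m ε)) (≼-≺-trans t≼
         (≺-from δ≺ (solveℝ 3 (λ m d e → m ⊕ e ⊕ d ⊜ m ⊕ d ⊕ e) refl m (fromℚ (δ k)) ε))))

infimum-≼ : ∀ {P m m′} → IsInfimum P m → IsInfimum P m′ → m ≼ m′
infimum-≼ {P} {m} {m′} (lower , _) (_ , approached) = ⊀⇒≽ λ m′≺m →
  let k , m′+δ≺m = ≺-room m′≺m
      t , t∈P , t< = approached (fromℚ (δ k)) (≺⇒< (0ℝ≺δ k))
  in ≺-asym m′+δ≺m (≼-≺-trans (≤⇒≼ (lower t t∈P)) (subst (t ≺_) (+≡∔ m′ (fromℚ (δ k))) (<⇒≺ t<)))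

measurable : ∀ {E m} → E ⊆ 𝕀 → Attains (CoverTotal E) m → Attains (CoverTotal (𝕀 ∖ E)) (1ℝ ∸ m) →
             Σ[ M ∈ Measurable E ] μ M ≡ m
measurable {E} {m} E⊆𝕀 attains attains′ = record
  { μ     = m
  ; E⊆𝕀   = λ {x} → E⊆𝕀 {x}
  ; outer = isInfimum cover-totals (proj₁ (m+1-m m)) attains attains′
  ; inner = subst (IsInfimum (CoverTotal (𝕀 ∖ E))) (sym (-≡∸ 1ℝ m))
      (isInfimum (λ {t} {t′} t∈ t′∈ → ≼-trans (cover-totals t′∈ t∈) (proj₁ (+-comm t′ t)))
        (≼-trans (proj₁ (+-comm (1ℝ ∸ m) m)) (proj₁ (m+1-m m))) attains′ attains)
  } , refl
  where
  m+1-m : ∀ m → m ∔ (1ℝ ∸ m) ≃ 1ℝ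
  m+1-m = solveℝ 1 (λ m → m ⊕ (rat 1ℚ ⊖ m) ⊜ rat 1ℚ) refl

μ-unique : ∀ {E} (M N : Measurable E) → μ M ≃ μ N
μ-unique M N = infimum-≼ (outer M) (outer N) , infimum-≼ (outer N) (outer M)
  where open Measurable

-- Covers by two intervals

open-interval : ∀ l h → l ≼ h → OpenInterval
open-interval l h l≼h = record { lo = l ; hi = h ; lo≤hi = ≼⇒≤ l≼h }

two : OpenInterval → OpenInterval → ℕ → OpenInterval
two A B 0             = A
two A B 1             = B
-- The filler (0, 0) is empty and has length 0.
two A B (suc (suc _)) = open-interval 0ℝ 0ℝ ≼-refl

module _ (A B : OpenInterval) where

  private
    lens : ℕ → ℝ
    lens n = len (two A B n)

    total : ℝ
    total = (hi A ∸ lo A) ∔ (hi B ∸ lo B)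

    step : ∀ n → partialSum lens (suc n) ≡ partialSum lens n ∔ (hi (two A B n) ∸ lo (two A B n))
    step n = trans (partialSum-suc lens n)
      (cong (partialSum lens n ∔_) (-≡∸ (hi (two A B n)) (lo (two A B n))))

  partialSum-two : ∀ i → partialSum lens (2 ℕ.+ i) ≃ total
  partialSum-two zero = subst (_≃ total)
    (sym (trans (step 1) (cong (_∔ (hi B ∸ lo B)) (step 0))))
    (solveℝ 2 (λ a b → rat 0ℚ ⊕ a ⊕ b ⊜ a ⊕ b) refl (hi A ∸ lo A) (hi B ∸ lo B))
  partialSum-two (suc i) = subst (_≃ total) (sym (step (2 ℕ.+ i)))
    (≃-trans (solveℝ 1 (λ s → s ⊕ (rat 0ℚ ⊖ rat 0ℚ) ⊜ s) refl (partialSum lens (2 ℕ.+ i)))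
      (partialSum-two i))

  hasSum-two : HasSum lens total
  hasSum-two ε 0<ε = 2 , λ where
    (suc (suc i)) _ →
      ≺⇒< (subst (_≺ partialSum lens (2 ℕ.+ i)) (sym (-≡∸ total ε))
        (≺-≼-trans (≺-from (<⇒≺ {0ℝ} {ε} 0<ε) (solveℝ 2 (λ s e → s ⊕ rat 0ℚ ⊜ s ⊖ e ⊕ e) refl total ε))
          (proj₂ (partialSum-two i)))) ,
      ≺⇒< (subst (partialSum lens (2 ℕ.+ i) ≺_) (sym (+≡∔ total ε))
        (≼-≺-trans (proj₁ (partialSum-two i))
          (≺-from (<⇒≺ {0ℝ} {ε} 0<ε) (solveℝ 2 (λ s e → s ⊕ e ⊕ rat 0ℚ ⊜ s ⊕ e) refl total ε))))
    1 (ℕ.s≤s ())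

  coverTotal-two : ∀ {E} → (∀ {x} → x ∈ E → x ∈ contains A ⊎ x ∈ contains B) → CoverTotal E total
  coverTotal-two covers = two A B ,
    (λ {x} x∈E → [ (λ x∈A → 0 , x∈A) , (λ x∈B → 1 , x∈B) ]′ (covers {x} x∈E)) , hasSum-two

module _ (k : ℕ) where

  private
    η : ℝ
    -- Two intervals are widened at both ends, at a total cost of 4 η = δ k.
    η = fromℚ (δ (2 ℕ.+ k))

  4η≼δ : η ∔ η ∔ (η ∔ η) ≼ fromℚ (δ k)
  4η≼δ = ≼-trans (+-mono-≼ (proj₂ (fromℚ-+ d d)) (proj₂ (fromℚ-+ d d)))
    (≼-trans (proj₂ (fromℚ-+ (d ℚ.+ d) (d ℚ.+ d)))
      (fromℚ-mono-≼ (ℚₚ.≤-reflexive (δ-quadruple k))))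
    where d = δ (2 ℕ.+ k)

  around : ∀ l h → l ≼ h → OpenInterval
  around l h l≼h = open-interval (l ∸ η) (h ∔ η)
    (≼-trans (≺⇒≼ (∸δ-≺ l (2 ℕ.+ k))) (≼-trans l≼h (≺⇒≼ (≺-∔δ h (2 ℕ.+ k)))))

  around-total : ∀ {l h l′ h′ m} → (h ∸ l) ∔ (h′ ∸ l′) ≼ m →
                 ((h ∔ η) ∸ (l ∸ η)) ∔ ((h′ ∔ η) ∸ (l′ ∸ η)) ≼ m ∔ fromℚ (δ k)
  around-total {l} {h} {l′} {h′} {m} total = ≼-from (+-mono-≼ total 4η≼δ)
    (solveℝ 7 (λ l h l′ h′ m e d →
       m ⊕ d ⊕ (h ⊖ l ⊕ (h′ ⊖ l′) ⊕ (e ⊕ e ⊕ (e ⊕ e))) ⊜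
       h ⊕ e ⊖ (l ⊖ e) ⊕ (h′ ⊕ e ⊖ (l′ ⊖ e)) ⊕ (m ⊕ d)) refl l h l′ h′ m η (fromℚ (δ k)))

∸-self : ∀ x → x ∸ x ≃ 0ℝ
∸-self = solveℝ 1 (λ x → x ⊖ x ⊜ rat 0ℚ) refl

-- Membership is asked only up to a margin `δ k`, which turns closed intervals into open ones and
-- leaves cotransitivity room to choose between them. A single interval is paired with [0, 0].
attains-two : ∀ {E l h l′ h′ m} → l ≼ h → l′ ≼ h′ → (h ∸ l) ∔ (h′ ∸ l′) ≼ m →
              (∀ k {x} → x ∈ E → (l ∸ fromℚ (δ k) ≺ x × x ≺ h ∔ fromℚ (δ k)) ⊎
                                 (l′ ∸ fromℚ (δ k) ≺ x × x ≺ h′ ∔ fromℚ (δ k))) →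
              Attains (CoverTotal E) m
attains-two {E} {l} {h} {l′} {h′} l≼h l′≼h′ total near k = _ ,
  coverTotal-two (around k l h l≼h) (around k l′ h′ l′≼h′) {E}
    (λ {x} x∈E → [ (λ (l≺x , x≺h) → inj₁ (≺⇒< l≺x , ≺⇒< x≺h))
                 , (λ (l≺x , x≺h) → inj₂ (≺⇒< l≺x , ≺⇒< x≺h)) ]′ (near (2 ℕ.+ k) {x} x∈E)) ,
  around-total k total

infixl 7 _⊛_

-- The measure of a⁰ ∩ b¹ = [1 - b, a].
_⊛_ : ℝ → ℝ → ℝ
a ⊛ b = 0ℝ ⊔ (a ∸ (1ℝ ∸ b))

0≼⊛ : ∀ a b → 0ℝ ≼ a ⊛ b
0≼⊛ a b = x≼x⊔y 0ℝ (a ∸ (1ℝ ∸ b))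

≼⊛ : ∀ a b → a ∸ (1ℝ ∸ b) ≼ a ⊛ b
≼⊛ a b = y≼x⊔y 0ℝ (a ∸ (1ℝ ∸ b))

0≼1 : 0ℝ ≼ 1ℝ
0≼1 = fromℚ-mono-≼ (ℚₚ.nonNegative⁻¹ 1ℚ)

0≼1∸ : ∀ {x} → x ≼ 1ℝ → 0ℝ ≼ 1ℝ ∸ x
0≼1∸ {x} x≼1 = ≼-from x≼1 (solveℝ 1 (λ x → rat 1ℚ ⊖ x ⊕ x ⊜ rat 0ℚ ⊕ rat 1ℚ) refl x)

1∸≼1 : ∀ {x} → 0ℝ ≼ x → 1ℝ ∸ x ≼ 1ℝ
1∸≼1 {x} 0≼x = ≼-from 0≼x (solveℝ 1 (λ x → rat 1ℚ ⊕ rat 0ℚ ⊜ rat 1ℚ ⊖ x ⊕ x) refl x)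

⊛≼1 : ∀ {a b} → a ≼ 1ℝ → b ≼ 1ℝ → a ⊛ b ≼ 1ℝ
⊛≼1 {a} {b} a≼1 b≼1 = ⊔-lub 0≼1 (≼-from (+-mono-≼ a≼1 (0≼1∸ b≼1))
  (solveℝ 2 (λ a b → rat 1ℚ ⊕ (a ⊕ rat 0ℚ) ⊜ a ⊖ (rat 1ℚ ⊖ b) ⊕ (rat 1ℚ ⊕ (rat 1ℚ ⊖ b))) refl a b))

∈-∩ : ∀ a b {x} → 0ℝ ≼ x → x ≼ 1ℝ → 1ℝ ∸ b ≼ x → x ≼ a → x ∈ a ⁰ ∩ b ¹
∈-∩ a b {x} 0≼x x≼1 c≼x x≼a =
  (≼⇒≤ 0≼x , ≼⇒≤ x≼a) , (≼⇒≤ (subst (_≼ x) (sym (-≡∸ 1ℝ b)) c≼x) , ≼⇒≤ x≼1)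

measurable-∩ : ∀ {a b} → 0ℝ ≼ a → a ≼ 1ℝ → 0ℝ ≼ b → b ≼ 1ℝ →
               Σ[ M ∈ Measurable (a ⁰ ∩ b ¹) ] μ M ≡ a ⊛ b
measurable-∩ {a} {b} 0≼a a≼1 0≼b b≼1 = measurable
  (λ ((0≤x , _) , (_ , x≤1)) → 0≤x , x≤1)
  (attains-two (x≼x⊔y c a) ≼-refl total near)
  (attains-two (0≼1∸ b≼1) (⊔-lub (1∸≼1 0≼b) a≼1) total′ near′)
  where
  c : ℝ
  c = 1ℝ ∸ b

  total : ((c ⊔ a) ∸ c) ∔ (0ℝ ∸ 0ℝ) ≼ a ⊛ b
  total = ≼-from
    (⊔-lub {c} {a} {(a ⊛ b) ∔ c}
      (≼-from (0≼⊛ a b) (solveℝ 2 (λ m c → m ⊕ c ⊕ rat 0ℚ ⊜ c ⊕ m) refl (a ⊛ b) c))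
      (≼-from (≼⊛ a b) (solveℝ 3 (λ m a c → m ⊕ c ⊕ (a ⊖ c) ⊜ a ⊕ m) refl (a ⊛ b) a c)))
    (solveℝ 3 (λ m c d → m ⊕ d ⊜ d ⊖ c ⊕ (rat 0ℚ ⊖ rat 0ℚ) ⊕ (m ⊕ c)) refl (a ⊛ b) c (c ⊔ a))

  near : ∀ k {x} → x ∈ a ⁰ ∩ b ¹ → (c ∸ fromℚ (δ k) ≺ x × x ≺ (c ⊔ a) ∔ fromℚ (δ k)) ⊎
                                   (0ℝ ∸ fromℚ (δ k) ≺ x × x ≺ 0ℝ ∔ fromℚ (δ k))
  near k {x} ((_ , x≤a) , (1-b≤x , _)) = inj₁
    ( ≼⇒∸δ≺ k (subst (_≼ x) (-≡∸ 1ℝ b) (≤⇒≼ 1-b≤x))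
    , ≼⇒≺∔δ k (≼-trans (≤⇒≼ {x} {a} x≤a) (y≼x⊔y c a)))

  total′ : (c ∸ 0ℝ) ∔ (1ℝ ∸ (c ⊔ a)) ≼ 1ℝ ∸ (a ⊛ b)
  total′ = ≼-from
    (⊔-lub {0ℝ} {a ∸ c} {(c ⊔ a) ∸ c}
      (≼-from (x≼x⊔y c a) (solveℝ 2 (λ c d → d ⊖ c ⊕ c ⊜ rat 0ℚ ⊕ d) refl c (c ⊔ a)))
      (≼-from (y≼x⊔y c a) (solveℝ 3 (λ a c d → d ⊖ c ⊕ a ⊜ a ⊖ c ⊕ d) refl a c (c ⊔ a))))
    (solveℝ 3 (λ m c d → rat 1ℚ ⊖ m ⊕ m ⊜ c ⊖ rat 0ℚ ⊕ (rat 1ℚ ⊖ d) ⊕ (d ⊖ c)) refl (a ⊛ b) c (c ⊔ a))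

  near′ : ∀ k {x} → x ∈ 𝕀 ∖ (a ⁰ ∩ b ¹) → (0ℝ ∸ fromℚ (δ k) ≺ x × x ≺ c ∔ fromℚ (δ k)) ⊎
                                          ((c ⊔ a) ∸ fromℚ (δ k) ≺ x × x ≺ 1ℝ ∔ fromℚ (δ k))
  -- x need not be comparable with c, but it is below c + δ k or above c. In the second case
  -- `x ≺ c ⊔ a` would force `x ≺ a` and put x into the excluded set.
  near′ k {x} ((0≤x , x≤1) , x∉E) = decide (≺-cotrans (≺-∔δ c k) x)
    where
    0≼x : 0ℝ ≼ x
    0≼x = ≤⇒≼ 0≤x
    x≼1 : x ≼ 1ℝ
    x≼1 = ≤⇒≼ x≤1
    above : c ≺ x → (c ⊔ a) ∸ fromℚ (δ k) ≺ x
    above c≺x =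
      [ id
      , (λ x≺c⊔a → [ (λ x≺c → contradiction x≺c (≺-asym c≺x))
                   , (λ x≺a → ⊥-elim (x∉E (∈-∩ a b {x} 0≼x x≼1 (≺⇒≼ c≺x) (≺⇒≼ x≺a))))
                   ]′ (≺-⊔ x≺c⊔a))
      ]′ (≺-cotrans (∸δ-≺ (c ⊔ a) k) x)
    decide : c ≺ x ⊎ x ≺ c ∔ fromℚ (δ k) →
             (0ℝ ∸ fromℚ (δ k) ≺ x × x ≺ c ∔ fromℚ (δ k)) ⊎
             ((c ⊔ a) ∸ fromℚ (δ k) ≺ x × x ≺ 1ℝ ∔ fromℚ (δ k))
    decide (inj₁ c≺x)   = inj₂ (above c≺x , ≼⇒≺∔δ k x≼1)
    decide (inj₂ x≺c+δ) = inj₁ (≼⇒∸δ≺ k 0≼x , x≺c+δ)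

measurable-∖ : ∀ {a} → 0ℝ ≼ a → a ≼ 1ℝ → Σ[ M ∈ Measurable (𝕀 ∖ a ⁰) ] μ M ≡ 1ℝ ∸ a
measurable-∖ {a} 0≼a a≼1 = measurable proj₁
  (attains-two a≼1 ≼-refl (proj₁ (drop 1ℝ a)) near)
  (attains-two 0≼a ≼-refl (proj₁ total′) near′)
  where
  drop : ∀ x y → (x ∸ y) ∔ (0ℝ ∸ 0ℝ) ≃ x ∸ y
  drop = solveℝ 2 (λ x y → x ⊖ y ⊕ (rat 0ℚ ⊖ rat 0ℚ) ⊜ x ⊖ y) refl

  near : ∀ k {x} → x ∈ 𝕀 ∖ a ⁰ → (a ∸ fromℚ (δ k) ≺ x × x ≺ 1ℝ ∔ fromℚ (δ k)) ⊎
                                 (0ℝ ∸ fromℚ (δ k) ≺ x × x ≺ 0ℝ ∔ fromℚ (δ k))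
  near k {x} ((0≤x , x≤1) , x∉a⁰) = inj₁
    ( [ id , (λ x≺a → ⊥-elim (x∉a⁰ (0≤x , ≼⇒≤ (≺⇒≼ x≺a)))) ]′ (≺-cotrans (∸δ-≺ a k) x)
    , ≼⇒≺∔δ k (≤⇒≼ {x} {1ℝ} x≤1))

  total′ : (a ∸ 0ℝ) ∔ (0ℝ ∸ 0ℝ) ≃ 1ℝ ∸ (1ℝ ∸ a)
  total′ = solveℝ 1 (λ a → a ⊖ rat 0ℚ ⊕ (rat 0ℚ ⊖ rat 0ℚ) ⊜ rat 1ℚ ⊖ (rat 1ℚ ⊖ a)) refl a

  near′ : ∀ k {x} → x ∈ 𝕀 ∖ (𝕀 ∖ a ⁰) → (0ℝ ∸ fromℚ (δ k) ≺ x × x ≺ a ∔ fromℚ (δ k)) ⊎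
                                        (0ℝ ∸ fromℚ (δ k) ≺ x × x ≺ 0ℝ ∔ fromℚ (δ k))
  near′ k {x} (x∈𝕀@(0≤x , _) , x∉𝕀∖a⁰) = inj₁
    ( ≼⇒∸δ≺ k (≤⇒≼ {0ℝ} {x} 0≤x)
    -- The double complement suffices because `x ≤ a` is itself a negation.
    , ≼⇒≺∔δ k (⊀⇒≽ λ a≺x → x∉𝕀∖a⁰ (x∈𝕀 , λ (_ , x≤a) → x≤a (≺⇒< a≺x))))

-- Operations on initial segments

⁰-cong : ∀ {a b} → a ≃ b → a ⁰ ≐ b ⁰
⁰-cong {a} {b} (a≼b , b≼a) =
  (λ {x} (0≤x , x≤a) → 0≤x , ≼⇒≤ (≼-trans (≤⇒≼ {x} {a} x≤a) a≼b)) ,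
  (λ {x} (0≤x , x≤b) → 0≤x , ≼⇒≤ (≼-trans (≤⇒≼ {x} {b} x≤b) b≼a))

⁰-cancel-≼ : ∀ {a b} → 0ℝ ≼ a → a ⁰ ⊆ b ⁰ → a ≼ b
⁰-cancel-≼ {a} 0≼a a⁰⊆b⁰ = ≤⇒≼ (proj₂ (a⁰⊆b⁰ {a} (≼⇒≤ 0≼a , ≼⇒≤ {a} ≼-refl)))

⁰-injective : ∀ {a b} → 0ℝ ≼ a → 0ℝ ≼ b → a ⁰ ≐ b ⁰ → a ≃ b
⁰-injective 0≼a 0≼b (a⁰⊆b⁰ , b⁰⊆a⁰) =
  ⁰-cancel-≼ 0≼a (λ {x} → a⁰⊆b⁰ {x}) , ⁰-cancel-≼ 0≼b (λ {x} → b⁰⊆a⁰ {x})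

end : 𝓘₀ → ℝ
end X = proj₁ (𝓘₀.initial X)

0≼end : ∀ X → 0ℝ ≼ end X
0≼end X = ≤⇒≼ (proj₁ (proj₁ (proj₂ (𝓘₀.initial X))))

end≼1 : ∀ X → end X ≼ 1ℝ
end≼1 X = ≤⇒≼ (proj₂ (proj₁ (proj₂ (𝓘₀.initial X))))

set≐ : ∀ X → set X ≐ end X ⁰
set≐ X = proj₂ (proj₂ (𝓘₀.initial X))

segment : ∀ a → 0ℝ ≼ a → a ≼ 1ℝ → 𝓘₀
segment a 0≼a a≼1 = record { set = a ⁰ ; initial = a , (≼⇒≤ 0≼a , ≼⇒≤ a≼1) , ≐-refl {x = a ⁰} }

end-unique : ∀ X {a} → 0ℝ ≼ a → set X ≐ a ⁰ → end X ≃ a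
end-unique X {a} 0≼a X≐a = ⁰-injective (0≼end X) 0≼a (≐-trans (≐-sym (set≐ X)) X≐a)

≋⇒≃ : ∀ X Y → X ≋ Y → end X ≃ end Y
≋⇒≃ X Y X≋Y = end-unique X (0≼end Y) (≐-trans X≋Y (set≐ Y))

≃⇒≋ : ∀ X Y → end X ≃ end Y → X ≋ Y
≃⇒≋ X Y x≃y = ≐-trans (set≐ X) (≐-trans (⁰-cong x≃y) (≐-sym (set≐ Y)))

∸-cong : ∀ {x y u v} → x ≃ y → u ≃ v → x ∸ u ≃ y ∸ v
∸-cong x≃y u≃v = +-cong x≃y (neg-cong u≃v)

⊛-cong : ∀ {a b c d} → a ≃ b → c ≃ d → a ⊛ c ≃ b ⊛ d
⊛-cong a≃b c≃d = ⊔-cong ≃-refl (∸-cong a≃b (∸-cong ≃-refl c≃d))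

operations : Operations
operations = record
  { _⊙_   = λ X Y → segment (end X ⊛ end Y) (0≼⊛ (end X) (end Y)) (⊛≼1 (end≼1 X) (end≼1 Y))
  ; ∼_    = λ X → segment (1ℝ ∸ end X) (0≼1∸ (end≼1 X)) (1∸≼1 (0≼end X))
  ; ⊙-def = λ X Y {a} {b} a∈𝕀 b∈𝕀 X≐a Y≐b →
      let M , μM≡ = measurable-∩ {a} {b} (≤⇒≼ (proj₁ a∈𝕀)) (≤⇒≼ (proj₂ a∈𝕀))
                      (≤⇒≼ (proj₁ b∈𝕀)) (≤⇒≼ (proj₂ b∈𝕀))
      in M , subst (λ m → (end X ⊛ end Y) ⁰ ≐ m ⁰) (sym μM≡)
        (⁰-cong (⊛-cong (end-unique X (≤⇒≼ (proj₁ a∈𝕀)) X≐a) (end-unique Y (≤⇒≼ (proj₁ b∈𝕀)) Y≐b)))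
  ; ∼-def = λ X {a} a∈𝕀 X≐a →
      let M , μM≡ = measurable-∖ {a} (≤⇒≼ (proj₁ a∈𝕀)) (≤⇒≼ (proj₂ a∈𝕀))
      in M , subst (λ m → (1ℝ ∸ end X) ⁰ ≐ m ⁰) (sym μM≡)
        (⁰-cong (∸-cong ≃-refl (end-unique X (≤⇒≼ (proj₁ a∈𝕀)) X≐a)))
  }

-- Laws of the Łukasiewicz conjunction max (0, a + b - 1)

⊛-comm : ∀ a b → a ⊛ b ≃ b ⊛ a
⊛-comm a b = ⊔-cong ≃-refl
  (solveℝ 2 (λ a b → a ⊖ (rat 1ℚ ⊖ b) ⊜ b ⊖ (rat 1ℚ ⊖ a)) refl a b)

⊛-zeroˡ : ∀ {a} → a ≼ 1ℝ → 0ℝ ⊛ a ≃ 0ℝ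
⊛-zeroˡ {a} a≼1 = ⊔-lub ≼-refl (≼-from a≼1
  (solveℝ 1 (λ a → rat 0ℚ ⊕ a ⊜ rat 0ℚ ⊖ (rat 1ℚ ⊖ a) ⊕ rat 1ℚ) refl a)) , 0≼⊛ 0ℝ a

⊛-identityˡ : ∀ {a} → 0ℝ ≼ a → 1ℝ ⊛ a ≃ a
⊛-identityˡ {a} 0≼a = ⊔-lub 0≼a (proj₁ 1-[1-a]) , ≼-trans (proj₂ 1-[1-a]) (≼⊛ 1ℝ a)
  where
  1-[1-a] : 1ℝ ∸ (1ℝ ∸ a) ≃ a
  1-[1-a] = solveℝ 1 (λ a → rat 1ℚ ⊖ (rat 1ℚ ⊖ a) ⊜ a) refl a

-- A symmetric closed form, which reduces associativity to a rotation of the summands. By c ≤ 1 the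
-- inner maximum with 0 does no harm: 0 + c - 1 is still at most 0.
⊛-triple : ∀ a b {c} → c ≼ 1ℝ → (a ⊛ b) ⊛ c ≃ 0ℝ ⊔ (a ∔ b ∔ c ∸ (1ℝ ∔ 1ℝ))
⊛-triple a b {c} c≼1 = ⊔-lub 0≼t (≼-from ab≼ (solveℝ 3 (λ ab c t →
    t ⊕ ab ⊜ ab ⊖ (rat 1ℚ ⊖ c) ⊕ (t ⊕ (rat 1ℚ ⊖ c))) refl (a ⊛ b) c t)) ,
  ⊔-lub (0≼⊛ (a ⊛ b) c) (≼-from (+-mono-≼ (≼⊛ a b) (≼⊛ (a ⊛ b) c)) (solveℝ 5 (λ a b c ab abc →
    abc ⊕ (a ⊖ (rat 1ℚ ⊖ b) ⊕ (ab ⊖ (rat 1ℚ ⊖ c))) ⊜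
    a ⊕ b ⊕ c ⊖ (rat 1ℚ ⊕ rat 1ℚ) ⊕ (ab ⊕ abc)) refl a b c (a ⊛ b) ((a ⊛ b) ⊛ c)))
  where
  t : ℝ
  t = 0ℝ ⊔ (a ∔ b ∔ c ∸ (1ℝ ∔ 1ℝ))
  0≼t : 0ℝ ≼ t
  0≼t = x≼x⊔y 0ℝ (a ∔ b ∔ c ∸ (1ℝ ∔ 1ℝ))
  ab≼ : a ⊛ b ≼ t ∔ (1ℝ ∸ c)
  ab≼ = ⊔-lub
    (≼-from (+-mono-≼ 0≼t (0≼1∸ c≼1))
      (solveℝ 2 (λ t d → t ⊕ d ⊕ (rat 0ℚ ⊕ rat 0ℚ) ⊜ rat 0ℚ ⊕ (t ⊕ d)) refl t (1ℝ ∸ c)))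
    (≼-from (y≼x⊔y 0ℝ (a ∔ b ∔ c ∸ (1ℝ ∔ 1ℝ))) (solveℝ 4 (λ a b c t →
      t ⊕ (rat 1ℚ ⊖ c) ⊕ (a ⊕ b ⊕ c ⊖ (rat 1ℚ ⊕ rat 1ℚ)) ⊜ a ⊖ (rat 1ℚ ⊖ b) ⊕ t) refl a b c t))

⊛-assoc : ∀ {a} b {c} → a ≼ 1ℝ → c ≼ 1ℝ → (a ⊛ b) ⊛ c ≃ a ⊛ (b ⊛ c)
⊛-assoc {a} b {c} a≼1 c≼1 = ≃-trans (⊛-triple a b c≼1) (≃-trans (⊔-cong ≃-refl rotate)
  (≃-trans (≃-sym (⊛-triple b c a≼1)) (⊛-comm (b ⊛ c) a)))
  where
  rotate : a ∔ b ∔ c ∸ (1ℝ ∔ 1ℝ) ≃ b ∔ c ∔ a ∸ (1ℝ ∔ 1ℝ)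
  rotate = solveℝ 3 (λ a b c → a ⊕ b ⊕ c ⊖ (rat 1ℚ ⊕ rat 1ℚ) ⊜ b ⊕ c ⊕ a ⊖ (rat 1ℚ ⊕ rat 1ℚ)) refl a b c

-- Both sides are the minimum of a and b.
exchange-≼ : ∀ a b → (1ℝ ∸ ((1ℝ ∸ a) ⊛ b)) ⊛ b ≼ (1ℝ ∸ ((1ℝ ∸ b) ⊛ a)) ⊛ a
exchange-≼ a b = ⊔-lub (0≼⊛ (1ℝ ∸ q) a) (≼-from (+-mono-≼ q≼ (≼⊛ (1ℝ ∸ q) a)) (solveℝ 5 (λ a b p q r →
    r ⊕ (q ⊕ (rat 1ℚ ⊖ q ⊖ (rat 1ℚ ⊖ a))) ⊜ rat 1ℚ ⊖ p ⊖ (rat 1ℚ ⊖ b) ⊕ (p ⊕ a ⊖ b ⊕ r)) refl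
    a b p q ((1ℝ ∸ q) ⊛ a)))
  where
  p q : ℝ
  p = (1ℝ ∸ a) ⊛ b
  q = (1ℝ ∸ b) ⊛ a
  -- Here p = max (0, b - a) and q = max (0, a - b), so that b - p ≤ a - q is what remains to be
  -- shown.
  q≼ : q ≼ p ∔ a ∸ b
  q≼ = ⊔-lub
    (≼-from (≼⊛ (1ℝ ∸ a) b) (solveℝ 3 (λ a b p →
      p ⊕ a ⊖ b ⊕ (rat 1ℚ ⊖ a ⊖ (rat 1ℚ ⊖ b)) ⊜ rat 0ℚ ⊕ p) refl a b p))
    (≼-from (0≼⊛ (1ℝ ∸ a) b) (solveℝ 3 (λ a b p →
      p ⊕ a ⊖ b ⊕ rat 0ℚ ⊜ rat 1ℚ ⊖ b ⊖ (rat 1ℚ ⊖ a) ⊕ p) refl a b p))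

≋-isEquivalence : IsEquivalence _≋_
≋-isEquivalence = record
  { refl  = λ {X} → ≐-refl {x = set X}
  ; sym   = ≐-sym
  ; trans = ≐-trans
  }

-- The laws for arbitrary `Operations`, read off from right endpoints

module _ (ops : Operations) where
  open Operations ops

  end-⊙ : ∀ X Y → end (X ⊙ Y) ≃ end X ⊛ end Y
  end-⊙ X Y =
    let x∈𝕀 , X≐ = proj₂ (𝓘₀.initial X)
        y∈𝕀 , Y≐ = proj₂ (𝓘₀.initial Y)
        M , X⊙Y≐ = ⊙-def X Y {end X} {end Y} x∈𝕀 y∈𝕀 X≐ Y≐
        N , μN≡  = measurable-∩ (0≼end X) (end≼1 X) (0≼end Y) (end≼1 Y)
        μM≃ = subst (μ M ≃_) μN≡ (μ-unique M N)
    in end-unique (X ⊙ Y) (0≼⊛ (end X) (end Y)) (≐-trans X⊙Y≐ (⁰-cong μM≃))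

  end-∼ : ∀ X → end (∼ X) ≃ 1ℝ ∸ end X
  end-∼ X =
    let x∈𝕀 , X≐ = proj₂ (𝓘₀.initial X)
        M , ∼X≐ = ∼-def X {end X} x∈𝕀 X≐
        N , μN≡ = measurable-∖ (0≼end X) (end≼1 X)
        μM≃ = subst (μ M ≃_) μN≡ (μ-unique M N)
    in end-unique (∼ X) (0≼1∸ (end≼1 X)) (≐-trans ∼X≐ (⁰-cong μM≃))

  end-⊙-cong : ∀ X Y {x y} → end X ≃ x → end Y ≃ y → end (X ⊙ Y) ≃ x ⊛ y
  end-⊙-cong X Y X≃x Y≃y = ≃-trans (end-⊙ X Y) (⊛-cong X≃x Y≃y)

  end-∼-cong : ∀ X {x} → end X ≃ x → end (∼ X) ≃ 1ℝ ∸ x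
  end-∼-cong X X≃x = ≃-trans (end-∼ X) (∸-cong ≃-refl X≃x)

  ⊙-cong : ∀ {X Y U V} → X ≋ Y → U ≋ V → (X ⊙ U) ≋ (Y ⊙ V)
  ⊙-cong {X} {Y} {U} {V} X≋Y U≋V = ≃⇒≋ (X ⊙ U) (Y ⊙ V)
    (≃-trans (end-⊙-cong X U (≋⇒≃ X Y X≋Y) (≋⇒≃ U V U≋V)) (≃-sym (end-⊙ Y V)))

  ⊙-assoc : ∀ X Y Z → ((X ⊙ Y) ⊙ Z) ≋ (X ⊙ (Y ⊙ Z))
  ⊙-assoc X Y Z = ≃⇒≋ ((X ⊙ Y) ⊙ Z) (X ⊙ (Y ⊙ Z))
    (≃-trans (end-⊙-cong (X ⊙ Y) Z (end-⊙ X Y) ≃-refl)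
      (≃-trans (⊛-assoc (end Y) (end≼1 X) (end≼1 Z))
        (≃-sym (end-⊙-cong X (Y ⊙ Z) ≃-refl (end-⊙ Y Z)))))

  ⊙-comm : ∀ X Y → (X ⊙ Y) ≋ (Y ⊙ X)
  ⊙-comm X Y = ≃⇒≋ (X ⊙ Y) (Y ⊙ X)
    (≃-trans (end-⊙ X Y) (≃-trans (⊛-comm (end X) (end Y)) (≃-sym (end-⊙ Y X))))

  ⊙-identityˡ : ∀ X → (𝟏 ⊙ X) ≋ X
  ⊙-identityˡ X = ≃⇒≋ (𝟏 ⊙ X) X (≃-trans (end-⊙ 𝟏 X) (⊛-identityˡ (0≼end X)))

  ⊙-zeroˡ : ∀ X → (𝟎 ⊙ X) ≋ 𝟎
  ⊙-zeroˡ X = ≃⇒≋ (𝟎 ⊙ X) 𝟎 (≃-trans (end-⊙ 𝟎 X) (⊛-zeroˡ (end≼1 X)))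

  ∼𝟏≋𝟎 : (∼ 𝟏) ≋ 𝟎
  ∼𝟏≋𝟎 = ≃⇒≋ (∼ 𝟏) 𝟎 (≃-trans (end-∼ 𝟏) (∸-self 1ℝ))

  isMVAlgebra : IsMVAlgebra _≋_ _⊙_ ∼_ 𝟏 𝟎
  isMVAlgebra = record
    { isCommutativeMonoid = record
      { isMonoid = record
        { isSemigroup = record
          { isMagma = record
            { isEquivalence = ≋-isEquivalence
            ; ∙-cong = λ {X} {Y} {U} {V} → ⊙-cong {X} {Y} {U} {V}
            }
          ; assoc = ⊙-assoc
          }
        ; identity = ⊙-identityˡ , λ X → ≐-trans (⊙-comm X 𝟏) (⊙-identityˡ X)
        }
      ; comm = ⊙-comm
      }
    ; ∼-cong       = λ {X} {Y} X≋Y → ≃⇒≋ (∼ X) (∼ Y)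
        (≃-trans (end-∼-cong X (≋⇒≃ X Y X≋Y)) (≃-sym (end-∼ Y)))
    ; ∼-involutive = λ X → ≃⇒≋ (∼ (∼ X)) X
        (≃-trans (end-∼-cong (∼ X) (end-∼ X))
          (solveℝ 1 (λ x → rat 1ℚ ⊖ (rat 1ℚ ⊖ x) ⊜ x) refl (end X)))
    ; u-absorbs    = ⊙-zeroˡ
    ; ∼e-absorbs   = λ X → ≐-trans (⊙-comm X (∼ 𝟏))
        (≐-trans (⊙-cong {∼ 𝟏} {𝟎} {X} {X} ∼𝟏≋𝟎 ≐-refl) (≐-trans (⊙-zeroˡ X) (≐-sym ∼𝟏≋𝟎)))
    ; exchange     = λ X Y → ≃⇒≋ (∼ (∼ X ⊙ Y) ⊙ Y) (∼ (∼ Y ⊙ X) ⊙ X)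
        (≃-trans (end-exchange X Y)
          (≃-trans (exchange-≼ (end X) (end Y) , exchange-≼ (end Y) (end X)) (≃-sym (end-exchange Y X))))
    }
    where
    end-exchange : ∀ X Y → end (∼ (∼ X ⊙ Y) ⊙ Y) ≃ (1ℝ ∸ ((1ℝ ∸ end X) ⊛ end Y)) ⊛ end Y
    end-exchange X Y = end-⊙-cong (∼ (∼ X ⊙ Y)) Y
      (end-∼-cong (∼ X ⊙ Y) (end-⊙-cong (∼ X) Y (end-∼ X) ≃-refl)) ≃-refl

theorem4 :
    Operations ×
    ((ops : Operations) → let open Operations ops in
      IsMVAlgebra _≋_ _⊙_ ∼_ 𝟏 𝟎)
theorem4 = operations , isMVAlgebra
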